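{- Let $H$ be a $3$-uniform hypergraph with $m$ edges. Then $H$ has a $2$-cut with excess at least $\left(\sqrt{24m+1}-1\right)/16$. If $H$ is connected and has $n$ vertices, then $H$ has a $2$-cut with excess at least $(n-1)/8$. Both bounds are best possible: if $H$ is any Steiner triple system, then the maximum excess of a $2$-cut of $H$ equals $\left(\sqrt{24m+1}-1\right)/16=(n-1)/8$. Moreover, if $H$ is a $3$-uniform hypergraph with $n$ vertices, none of which is isolated, then $H$ has a $2$-cut with excess at least $n/12$. This bound is also best possible: if $H$ is a perfect matching, the maximum excess of a $2$-cut of $H$ equals $n/12$.
   Context: A $k$-uniform hypergraph ($k$-graph) has a vertex set and a set of $k$-element subsets (edges). For $2\le r\le k$, an $r$-cut of a $k$-graph $H$ is a partition of $V(H)$ into $r$ (possibly empty) labelled parts; its size is the number of edges having a vertex in every part (such edges are called multicoloured). The excess of an $r$-cut of an $m$-edge $k$-graph is its size minus $\frac{S(k,r)r!}{r^k}m$, where $S(k,r)$ is the Stirling number of the second kind; this subtracted quantity is the expected size of a uniformly random $r$-cut. For $k=3,r=2$ it equals $\frac34 m$. A Steiner triple system is a $3$-graph in which every pair of vertices lies in exactly one edge. A perfect matching is a $k$-graph in which every vertex lies in exactly one edge. A vertex is isolated if it lies in no edge. -}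

module Defs where

open import Data.Nat as ℕ using (ℕ; zero; suc)
open import Data.Integer as ℤ using (ℤ; +_)
open import Data.Rational as ℚ using (ℚ; _/_; 0ℚ)
open import Data.Fin using (Fin; _<_; _≟_)
open import Data.Fin.Properties using (all?)
open import Data.List using (List; length; filter)
open import Data.List.Relation.Unary.Unique.Propositional using (Unique)
open import Data.List.Relation.Unary.Any using (Any)
open import Data.Product using (_×_; Σ; ∃)
open import Data.Sum using (_⊎_)
open import Relation.Nullary using (Dec; ¬_)
open import Relation.Nullary.Decidable using (_⊎-dec_; _×-dec_)
open import Relation.Binary.PropositionalEquality using (_≡_; _≢_)

-- A 3-element subset {a,b,c} of the vertex set Fin n, written canonically with a < b < c.
record Edge (n : ℕ) : Set where
  constructor edge
  field
    a b c : Fin n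
    a<b : a < b
    b<c : b < c
open Edge public

record Graph3 (n : ℕ) : Set where
  constructor graph3
  field
    edges  : List (Edge n)
    unique : Unique edges
open Graph3 public

m : ∀ {n} → Graph3 n → ℕ
m H = length (edges H)

_∈e_ : ∀ {n} → Fin n → Edge n → Set
v ∈e e = v ≡ a e ⊎ v ≡ b e ⊎ v ≡ c e

_∈e?_ : ∀ {n} (v : Fin n) (e : Edge n) → Dec (v ∈e e)
v ∈e? e = (v ≟ a e) ⊎-dec ((v ≟ b e) ⊎-dec (v ≟ c e))

pairDegree : ∀ {n} → Graph3 n → Fin n → Fin n → ℕ
pairDegree H u v = length (filter (λ e → (u ∈e? e) ×-dec (v ∈e? e)) (edges H))

degree : ∀ {n} → Graph3 n → Fin n → ℕ
degree H v = length (filter (λ e → v ∈e? e) (edges H))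

Cut2 : ℕ → Set
Cut2 n = Fin n → Fin 2

Multicoloured : ∀ {n} → Cut2 n → Edge n → Set
Multicoloured f e = ∀ (i : Fin 2) → f (a e) ≡ i ⊎ f (b e) ≡ i ⊎ f (c e) ≡ i

multicoloured? : ∀ {n} (f : Cut2 n) (e : Edge n) → Dec (Multicoloured f e)
multicoloured? f e = all? λ i → (f (a e) ≟ i) ⊎-dec ((f (b e) ≟ i) ⊎-dec (f (c e) ≟ i))

cutSize : ∀ {n} → Graph3 n → Cut2 n → ℕ
cutSize H f = length (filter (multicoloured? f) (edges H))

-- excess = size − S(3,2)·2!/2^3 · m = size − (3/4) m
excess : ∀ {n} → Graph3 n → Cut2 n → ℚ
excess H f = (+ cutSize H f / 1) ℚ.- ((+ 3 / 4) ℚ.* (+ m H / 1))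

ℕtoℚ : ℕ → ℚ
ℕtoℚ k = + k / 1

√_≤_ : ℕ → ℚ → Set
√ x ≤ y = (0ℚ ℚ.≤ y) × (ℕtoℚ x ℚ.≤ y ℚ.* y)

IsSqrt : ℕ → ℚ → Set
IsSqrt x y = (0ℚ ℚ.≤ y) × (y ℚ.* y ≡ ℕtoℚ x)

data Reach {n} (H : Graph3 n) : Fin n → Fin n → Set where
  here  : ∀ {u} → Reach H u u
  step  : ∀ {u w v} (e : Edge n) → Any (e ≡_) (edges H) → u ∈e e → w ∈e e →
          Reach H w v → Reach H u v

Connected : ∀ {n} → Graph3 n → Set
Connected H = ∀ u v → Reach H u v

Steiner : ∀ {n} → Graph3 n → Set
Steiner H = ∀ u v → u ≢ v → pairDegree H u v ≡ 1

PerfectMatching : ∀ {n} → Graph3 n → Set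
PerfectMatching H = ∀ v → degree H v ≡ 1

NoIsolated : ∀ {n} → Graph3 n → Set
NoIsolated H = ∀ v → Any (v ∈e_) (edges H)

MaxExcessIs : ∀ {n} → Graph3 n → ℚ → Set
MaxExcessIs {n} H q = (Σ (Cut2 n) λ f → excess H f ≡ q) × (∀ (f : Cut2 n) → excess H f ℚ.≤ q)

{-# OPTIONS --safe #-}

-- Give the vertices signs x v = ±1 according to their part.  An edge {a,b,c} contributes
-- xa xb + xb xc + xa xc = -1 to Q x if it is multicoloured and 3 otherwise, so the excess of the
-- cut is -Q x / 4.  Since Q (x + y) + Q (x - y) = 2 Q x + 2 Q y, sign vectors on disjoint sets of
-- vertices can be combined, after possibly negating one, without increasing the sum of their forms.
--
-- A star v ∪ L whose leaves are pairwise nonadjacent has Q ≤ -|L|.  In a depth-first search tree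
-- distinct subtrees are not adjacent, so collecting at each vertex its uncovered children covers
-- all of a component, except possibly its root, by such stars; this gives -2 Q ≥ |component| - 1.
-- If no vertex is isolated, components have at least 3 vertices, whence -3 Q ≥ n.
--
-- For the bound in m, colour the vertices so that every edge is rainbow and any two of the k colours
-- meet in an edge; then k (k - 1) ≤ 6 m.  The complete graph on the colours splits into k matchings,
-- so some matching accounts for a 1/k fraction of the 3 m pairs in edges, and giving matched colours
-- opposite signs yields -k Q ≥ 3 m.  The two inequalities imply 3 m ≤ q (2 q + 1) for q = -Q.
--
-- In a Steiner triple system 2 Q x = (Σ x)² - n with n odd.
module Submission where

open import Defs

module _ where

  import Algebra.Solver.CommutativeMonoid as CMSolver
  open import Data.Fin as Fin using (Fin; zero; suc; toℕ; _≟_)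
  import Data.Fin.Properties as Finₚ
  open import Data.Integer hiding (suc; sign; _<_; _≟_)
  open import Data.Integer.Properties hiding (_≟_)
  open import Data.Integer.Tactic.RingSolver using (solve-∀)
  open import Data.List using (List; []; _∷_; _++_; [_]; length; filter; allFin; tabulate; lookup)
  open import Data.List.Properties using (length-++; length-filter; length-tabulate)
  open import Data.List.Membership.Propositional using (_∈_; _∉_; find; lose)
  open import Data.List.Membership.Propositional.Properties
    using (∈-++⁺ˡ; ∈-++⁺ʳ; ∈-++⁻; ∈-∃++; ∈-allFin; ∈-filter⁻)
  open import Data.List.Relation.Binary.Disjoint.Propositional using (Disjoint)
  open import Data.List.Relation.Binary.Permutation.Propositional
    using (_↭_; ↭-sym; ↭-trans; ↭-refl; ↭-prep; ↭-swap; ↭⇒↭ₛ)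
  open import Data.List.Relation.Binary.Permutation.Propositional.Properties
    using (∈-resp-↭; ↭-length; ++-commutativeMonoid; shift; ++⁺ˡ; ++-identityʳ)
  import Data.List.Relation.Binary.Permutation.Setoid.Properties as Permₛ
  open import Data.List.Relation.Unary.All using (_∷_)
  open import Data.List.Relation.Unary.AllPairs using (_∷_)
  open import Data.List.Relation.Unary.Any as Any using (Any; here; there)
  open import Data.List.Relation.Unary.Any.Properties using (lookup-index)
  open import Data.List.Relation.Unary.Unique.Propositional using (Unique)
  open import Data.List.Relation.Unary.Unique.Propositional.Properties using (allFin⁺; Unique[x∷xs]⇒x∉xs)
  open import Data.Nat as ℕ using (ℕ; zero; suc; z≤n; s≤s)
  import Data.Nat.Properties as ℕₚ
  open import Data.Product using (Σ; ∃; _×_; _,_; proj₁; proj₂; map₂)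
  open import Data.Rational as ℚ using (fromℚᵘ; 1ℚ)
  import Data.Rational.Properties as ℚₚ
  open import Data.Rational.Unnormalised as ℚᵘ using (mkℚᵘ; *≡*; *≤*)
  import Data.Rational.Unnormalised.Properties as ℚᵘₚ
  open import Data.Sum using (_⊎_; inj₁; inj₂)
  open import Function using (_∘_; id)
  open import Relation.Binary.PropositionalEquality hiding ([_])
  open import Relation.Nullary using (Dec; yes; no; ¬_; contradiction)
  open import Relation.Nullary.Decidable using (_×-dec_; _⊎-dec_; ¬?; decidable-stable)

  -- Sums of integers over lists

  -- Turns linear arithmetic into ring identities: the wanted inequality has the same gap as a known
  -- one, and the ring solver verifies that the gaps agree.
  ≤-lin : ∀ {i j k l} → i ≤ j → j - i ≡ l - k → k ≤ l
  ≤-lin i≤j eq = 0≤i-j⇒j≤i (subst (0ℤ ≤_) eq (i≤j⇒0≤j-i i≤j))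

  ∑ : {A : Set} → List A → (A → ℤ) → ℤ
  ∑ []       f = 0ℤ
  ∑ (x ∷ xs) f = f x + ∑ xs f

  module _ {A : Set} where

    ∑-cong : ∀ {f g : A → ℤ} xs → (∀ x → f x ≡ g x) → ∑ xs f ≡ ∑ xs g
    ∑-cong []       eq = refl
    ∑-cong (x ∷ xs) eq = cong₂ _+_ (eq x) (∑-cong xs eq)

    ∑-+ : ∀ (f g : A → ℤ) xs → ∑ xs (λ x → f x + g x) ≡ ∑ xs f + ∑ xs g
    ∑-+ f g []       = refl
    ∑-+ f g (x ∷ xs) = trans (cong (_+_ (f x + g x)) (∑-+ f g xs)) (lemma (f x) (g x) _ _)
      where
      lemma : ∀ a b c d → a + b + (c + d) ≡ a + c + (b + d)
      lemma = solve-∀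

    ∑-+₃ : ∀ (f g h : A → ℤ) xs → ∑ xs (λ x → f x + g x + h x) ≡ ∑ xs f + ∑ xs g + ∑ xs h
    ∑-+₃ f g h xs = trans (∑-+ (λ x → f x + g x) h xs) (cong (λ z → z + ∑ xs h) (∑-+ f g xs))

    ∑-* : ∀ c (f : A → ℤ) xs → ∑ xs (λ x → c * f x) ≡ c * ∑ xs f
    ∑-* c f []       = sym (*-zeroʳ c)
    ∑-* c f (x ∷ xs) = trans (cong (_+_ (c * f x)) (∑-* c f xs)) (sym (*-distribˡ-+ c (f x) _))

    ∑-const : ∀ c (xs : List A) → ∑ xs (λ _ → c) ≡ + length xs * c
    ∑-const c []       = refl
    ∑-const c (x ∷ xs) = trans (cong (_+_ c) (∑-const c xs)) (sym (suc-* (+ length xs) c))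

  ∑-swap : ∀ {A B : Set} (f : A → B → ℤ) xs ys →
           ∑ xs (λ x → ∑ ys (f x)) ≡ ∑ ys (λ y → ∑ xs (λ x → f x y))
  ∑-swap f []       ys = sym (trans (∑-const 0ℤ ys) (*-zeroʳ (+ length ys)))
  ∑-swap f (x ∷ xs) ys = trans (cong (_+_ (∑ ys (f x))) (∑-swap f xs ys))
    (sym (∑-+ (f x) (λ y → ∑ xs (λ x′ → f x′ y)) ys))

  ∑-mono : {A : Set} {f g : A → ℤ} (xs : List A) → (∀ {x} → x ∈ xs → f x ≤ g x) → ∑ xs f ≤ ∑ xs g
  ∑-mono []       f≤g = ≤-refl
  ∑-mono (x ∷ xs) f≤g = +-mono-≤ (f≤g (here refl)) (∑-mono xs (f≤g ∘ there))

  ∑-nonneg : {A : Set} (f : A → ℤ) (xs : List A) → (∀ {x} → x ∈ xs → 0ℤ ≤ f x) → 0ℤ ≤ ∑ xs f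
  ∑-nonneg f []       0≤f = ≤-refl
  ∑-nonneg f (x ∷ xs) 0≤f = +-mono-≤ (0≤f (here refl)) (∑-nonneg f xs (0≤f ∘ there))

  ∑-positive : {A : Set} (f : A → ℤ) (xs : List A) → (∀ {x} → x ∈ xs → 0ℤ ≤ f x) →
               ∀ {x} → x ∈ xs → 1ℤ ≤ f x → 1ℤ ≤ ∑ xs f
  ∑-positive f (x ∷ xs) 0≤f (here refl) 1≤fx = +-mono-≤ 1≤fx (∑-nonneg f xs (0≤f ∘ there))
  ∑-positive f (x ∷ xs) 0≤f (there x∈)  1≤fx = +-mono-≤ (0≤f (here refl))
    (∑-positive f xs (0≤f ∘ there) x∈ 1≤fx)

  ⟦_⟧ : {P : Set} → Dec P → ℤ
  ⟦ yes _ ⟧ = 1ℤ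
  ⟦ no _ ⟧  = 0ℤ

  ⟦⟧-yes : {P : Set} → P → (d : Dec P) → ⟦ d ⟧ ≡ 1ℤ
  ⟦⟧-yes p (yes _) = refl
  ⟦⟧-yes p (no ¬p) = contradiction p ¬p

  ⟦⟧-no : {P : Set} → ¬ P → (d : Dec P) → ⟦ d ⟧ ≡ 0ℤ
  ⟦⟧-no ¬p (yes p) = contradiction p ¬p
  ⟦⟧-no ¬p (no _)  = refl

  ⟦⟧-nonneg : {P : Set} (d : Dec P) → 0ℤ ≤ ⟦ d ⟧
  ⟦⟧-nonneg (yes _) = +≤+ z≤n
  ⟦⟧-nonneg (no _)  = ≤-refl

  ⟦⟧-× : {P R : Set} (d : Dec P) (d′ : Dec R) → ⟦ d ×-dec d′ ⟧ ≡ ⟦ d ⟧ * ⟦ d′ ⟧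
  ⟦⟧-× (yes _) (yes _) = refl
  ⟦⟧-× (yes _) (no _)  = refl
  ⟦⟧-× (no _)  d′      = refl

  ⟦⟧-idem : {P : Set} (d : Dec P) → ⟦ d ⟧ * ⟦ d ⟧ ≡ ⟦ d ⟧
  ⟦⟧-idem (yes _) = refl
  ⟦⟧-idem (no _)  = refl

  ∑-filter : {A : Set} {P : A → Set} (P? : ∀ x → Dec (P x)) (xs : List A) →
             + length (filter P? xs) ≡ ∑ xs (λ x → ⟦ P? x ⟧)
  ∑-filter P? []       = refl
  ∑-filter P? (x ∷ xs) with P? x
  ... | yes _ = cong (_+_ 1ℤ) (∑-filter P? xs)
  ... | no _  = trans (∑-filter P? xs) (sym (+-identityˡ _))

  ∑-zero : {A : Set} {f : A → ℤ} (xs : List A) → (∀ {x} → x ∈ xs → f x ≡ 0ℤ) → ∑ xs f ≡ 0ℤ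
  ∑-zero []       f≡0 = refl
  ∑-zero (x ∷ xs) f≡0 = cong₂ _+_ (f≡0 (here refl)) (∑-zero xs (f≡0 ∘ there))

  ∑-indicator : ∀ {n} (g : Fin n → ℤ) t (xs : List (Fin n)) → Unique xs → t ∈ xs →
    ∑ xs (λ v → ⟦ t ≟ v ⟧ * g v) ≡ g t
  ∑-indicator g t (v ∷ xs) uniq@(_ ∷ _) (here refl) = trans (cong₂ _+_
      (trans (cong (λ z → z * g t) (⟦⟧-yes refl (t ≟ t))) (*-identityˡ (g t)))
      (∑-zero xs λ {w} w∈ → cong (λ z → z * g w) (⟦⟧-no (λ { refl → Unique[x∷xs]⇒x∉xs uniq w∈ }) (t ≟ w))))
    (+-identityʳ (g t))
  ∑-indicator g t (v ∷ xs) uniq@(_ ∷ uniq′) (there t∈) = trans (cong₂ _+_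
      (cong (λ z → z * g v) (⟦⟧-no (λ { refl → Unique[x∷xs]⇒x∉xs uniq t∈ }) (t ≟ v)))
      (∑-indicator g t xs uniq′ t∈))
    (+-identityˡ (g t))

  ∑-allFin-indicator : ∀ {n} (g : Fin n → ℤ) t → ∑ (allFin n) (λ v → ⟦ t ≟ v ⟧ * g v) ≡ g t
  ∑-allFin-indicator {n} g t = ∑-indicator g t (allFin n) (allFin⁺ n) (∈-allFin t)

  -- Splitting off the head keeps the list nonempty, so that there is an element to choose.
  average≤maximum : {A : Set} (g : A → ℤ) (x : A) (xs : List A) → ∃ λ y → ∑ (x ∷ xs) g ≤ + length (x ∷ xs) * g y
  average≤maximum g x []       = x , ≤-reflexive (trans (+-identityʳ (g x)) (sym (*-identityˡ (g x))))
  average≤maximum g x (y ∷ ys) with z , le ← average≤maximum g y ys with ≤-total (g x) (g z)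
  ... | inj₁ gx≤gz = z , ≤-trans (+-mono-≤ gx≤gz le) (≤-reflexive (sym (suc-* (+ length (y ∷ ys)) (g z))))
  ... | inj₂ gz≤gx = x , ≤-trans (+-monoʳ-≤ (g x) (≤-trans le (*-monoˡ-≤-nonNeg (+ length (y ∷ ys)) gz≤gx)))
                             (≤-reflexive (sym (suc-* (+ length (y ∷ ys)) (g x))))

  ∑-allFin-const : ∀ n z → ∑ (allFin n) (λ _ → z) ≡ + n * z
  ∑-allFin-const n z = trans (∑-const z (allFin n)) (cong (λ l → + l * z) (length-tabulate {n = n} id))

  -- The quadratic form of a cut

  Unit : ℤ → Set
  Unit z = z ≡ 1ℤ ⊎ z ≡ -1ℤ

  unit-* : ∀ {s z} → Unit s → Unit z → Unit (s * z)
  unit-* (inj₁ refl) (inj₁ refl) = inj₁ refl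
  unit-* (inj₁ refl) (inj₂ refl) = inj₂ refl
  unit-* (inj₂ refl) (inj₁ refl) = inj₂ refl
  unit-* (inj₂ refl) (inj₂ refl) = inj₁ refl

  q : ∀ {n} → (Fin n → ℤ) → Edge n → ℤ
  q x e = x (a e) * x (b e) + x (b e) * x (c e) + x (a e) * x (c e)

  Q : ∀ {n} → Graph3 n → (Fin n → ℤ) → ℤ
  Q H x = ∑ (edges H) (q x)

  spin : Fin 2 → ℤ
  spin zero    = 1ℤ
  spin (suc _) = -1ℤ

  -- Four times the excess: with the denominator cleared, the argument stays in the integers until
  -- the last section.
  surplus : ∀ {n} → Graph3 n → Cut2 n → ℤ
  surplus H f = + 4 * + cutSize H f - + 3 * + m H

  q-cong : ∀ {n} {x y : Fin n → ℤ} → (∀ v → x v ≡ y v) → ∀ e → q x e ≡ q y e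
  q-cong eq e rewrite eq (a e) | eq (b e) | eq (c e) = refl

  q-spin : ∀ (i j k : Fin 2) →
    ((∀ l → i ≡ l ⊎ j ≡ l ⊎ k ≡ l) → spin i * spin j + spin j * spin k + spin i * spin k ≡ -1ℤ) ×
    (¬ (∀ l → i ≡ l ⊎ j ≡ l ⊎ k ≡ l) → spin i * spin j + spin j * spin k + spin i * spin k ≡ + 3)
  q-spin zero zero zero = (λ s → contradiction (s (suc zero)) λ
    { (inj₁ ()) ; (inj₂ (inj₁ ())) ; (inj₂ (inj₂ ())) }) , λ _ → refl
  q-spin (suc zero) (suc zero) (suc zero) =
    (λ s → contradiction (s zero) λ { (inj₁ ()) ; (inj₂ (inj₁ ())) ; (inj₂ (inj₂ ())) }) , λ _ → refl
  q-spin zero zero (suc zero) = (λ _ → refl) , λ ¬s →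
    contradiction (λ { zero → inj₁ refl ; (suc zero) → inj₂ (inj₂ refl) }) ¬s
  q-spin zero (suc zero) zero = (λ _ → refl) , λ ¬s →
    contradiction (λ { zero → inj₁ refl ; (suc zero) → inj₂ (inj₁ refl) }) ¬s
  q-spin zero (suc zero) (suc zero) = (λ _ → refl) , λ ¬s →
    contradiction (λ { zero → inj₁ refl ; (suc zero) → inj₂ (inj₁ refl) }) ¬s
  q-spin (suc zero) zero zero = (λ _ → refl) , λ ¬s →
    contradiction (λ { zero → inj₂ (inj₁ refl) ; (suc zero) → inj₁ refl }) ¬s
  q-spin (suc zero) zero (suc zero) = (λ _ → refl) , λ ¬s →
    contradiction (λ { zero → inj₂ (inj₁ refl) ; (suc zero) → inj₁ refl }) ¬s
  q-spin (suc zero) (suc zero) zero = (λ _ → refl) , λ ¬s →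
    contradiction (λ { zero → inj₂ (inj₂ refl) ; (suc zero) → inj₁ refl }) ¬s

  -- Holds edge by edge: 4 times the indicator of being multicoloured, minus 3, is 1 or -3, and
  -- `q-spin` gives the values -1 and 3 for `q`.
  surplus≡-Q : ∀ {n} (H : Graph3 n) f → surplus H f ≡ - Q H (spin ∘ f)
  surplus≡-Q H f = begin
    + 4 * + cutSize H f - + 3 * + m H
      ≡⟨ cong (λ z → + 4 * z - + 3 * + m H) (∑-filter (multicoloured? f) (edges H)) ⟩
    + 4 * ∑ (edges H) (λ e → ⟦ multicoloured? f e ⟧) - + 3 * + m H
      ≡⟨ cong₂ _+_ (sym (∑-* (+ 4) _ (edges H))) (trans (scale (+ m H)) (sym (∑-const -[1+ 2 ] (edges H)))) ⟩
    ∑ (edges H) (λ e → + 4 * ⟦ multicoloured? f e ⟧) + ∑ (edges H) (λ _ → -[1+ 2 ])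
      ≡⟨ ∑-+ _ _ (edges H) ⟨
    ∑ (edges H) (λ e → + 4 * ⟦ multicoloured? f e ⟧ + -[1+ 2 ])
      ≡⟨ ∑-cong (edges H) (λ e → term e (multicoloured? f e)) ⟩
    ∑ (edges H) (λ e → -1ℤ * q (spin ∘ f) e)
      ≡⟨ ∑-* -1ℤ _ (edges H) ⟩
    -1ℤ * Q H (spin ∘ f)
      ≡⟨ -1*i≡-i _ ⟩
    - Q H (spin ∘ f) ∎
    where
    open ≡-Reasoning
    scale : ∀ i → - (+ 3 * i) ≡ i * -[1+ 2 ]
    scale = solve-∀
    term : ∀ e (d : Dec (Multicoloured f e)) → + 4 * ⟦ d ⟧ + -[1+ 2 ] ≡ -1ℤ * q (spin ∘ f) e
    term e (yes mc) = cong (_*_ -1ℤ) (sym (proj₁ (q-spin (f (a e)) (f (b e)) (f (c e))) mc))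
    term e (no ¬mc) = cong (_*_ -1ℤ) (sym (proj₂ (q-spin (f (a e)) (f (b e)) (f (c e))) ¬mc))

  unit-spin : ∀ {z} → Unit z → ∃ λ i → spin i ≡ z
  unit-spin (inj₁ refl) = zero , refl
  unit-spin (inj₂ refl) = suc zero , refl

  spin-unit : ∀ i → Unit (spin i)
  spin-unit zero       = inj₁ refl
  spin-unit (suc zero) = inj₂ refl

  cut-of : ∀ {n} (H : Graph3 n) x → (∀ v → Unit (x v)) → ∃ λ f → surplus H f ≡ - Q H x
  cut-of H x u = (λ v → proj₁ (unit-spin (u v))) ,
    trans (surplus≡-Q H _) (cong -_ (∑-cong (edges H) (q-cong (λ v → proj₂ (unit-spin (u v))))))

  -- Polarisation: Q (x + y) + Q (x - y) = 2 Q x + 2 Q y.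
  join : ∀ {n} (H : Graph3 n) x y → ∃ λ s → Unit s × Q H (λ v → x v + s * y v) ≤ Q H x + Q H y
  join H x y with ≤-total (Q H (λ v → x v + 1ℤ * y v)) (Q H x + Q H y)
  ... | inj₁ le = 1ℤ , inj₁ refl , le
  -- The forms of `x + y` and `x - y` add up to twice the bound, so if the first reaches it the
  -- second does not exceed it.
  ... | inj₂ ge = -1ℤ , inj₂ refl , average (Q H (λ v → x v + 1ℤ * y v)) _ (Q H x) (Q H y) polarise ge
    where
    average : ∀ p n i j → p + n ≡ (i + i) + (j + j) → i + j ≤ p → n ≤ i + j
    average p n i j eq le = ≤-lin le (begin
      p - (i + j)                           ≡⟨ expand p n i j ⟩
      (p + n) - (n + (i + j))               ≡⟨ cong (λ z → z - (n + (i + j))) eq ⟩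
      ((i + i) + (j + j)) - (n + (i + j))   ≡⟨ collect n i j ⟩
      (i + j) - n                           ∎)
      where
      open ≡-Reasoning
      expand : ∀ p n i j → p - (i + j) ≡ (p + n) - (n + (i + j))
      expand = solve-∀
      collect : ∀ n i j → ((i + i) + (j + j)) - (n + (i + j)) ≡ (i + j) - n
      collect = solve-∀
    term : ∀ a b c a′ b′ c′ →
      ((a + 1ℤ * a′) * (b + 1ℤ * b′) + (b + 1ℤ * b′) * (c + 1ℤ * c′) + (a + 1ℤ * a′) * (c + 1ℤ * c′)) +
      ((a + -1ℤ * a′) * (b + -1ℤ * b′) + (b + -1ℤ * b′) * (c + -1ℤ * c′) + (a + -1ℤ * a′) * (c + -1ℤ * c′)) ≡
      ((a * b + b * c + a * c) + (a * b + b * c + a * c)) +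
        ((a′ * b′ + b′ * c′ + a′ * c′) + (a′ * b′ + b′ * c′ + a′ * c′))
    term = solve-∀
    polarise : Q H (λ v → x v + 1ℤ * y v) + Q H (λ v → x v + -1ℤ * y v) ≡ (Q H x + Q H x) + (Q H y + Q H y)
    polarise = trans (sym (∑-+ _ _ (edges H)))
      (trans (∑-cong (edges H) (λ e → term (x (a e)) (x (b e)) (x (c e)) (y (a e)) (y (b e)) (y (c e))))
      (trans (∑-+ _ _ (edges H)) (cong₂ _+_ (∑-+ _ _ (edges H)) (∑-+ _ _ (edges H)))))

  -- Depth-first search

  module _ {A : Set} where

    Unique-resp-↭ : ∀ {xs ys : List A} → xs ↭ ys → Unique xs → Unique ys
    Unique-resp-↭ p = Permₛ.Unique-resp-↭ (setoid A) (↭⇒↭ₛ p)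

    Unique-++⁻ʳ : ∀ (xs : List A) {ys} → Unique (xs ++ ys) → Unique ys
    Unique-++⁻ʳ []       u       = u
    Unique-++⁻ʳ (x ∷ xs) (_ ∷ u) = Unique-++⁻ʳ xs u

    Unique⇒Disjoint : ∀ (xs : List A) {ys} → Unique (xs ++ ys) → Disjoint xs ys
    Unique⇒Disjoint (x ∷ xs) u@(_ ∷ _) (here refl , x∈ys) = Unique[x∷xs]⇒x∉xs u (∈-++⁺ʳ xs x∈ys)
    Unique⇒Disjoint (x ∷ xs) (_ ∷ u)   (there x∈xs , x∈ys) = Unique⇒Disjoint xs u (x∈xs , x∈ys)

    ∈⇒↭ : ∀ {x : A} {xs} → x ∈ xs → ∃ λ ys → xs ↭ x ∷ ys
    ∈⇒↭ x∈xs with ys , zs , refl ← ∈-∃++ x∈xs = ys ++ zs , shift _ ys zs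

  δ : ∀ {n} → Fin n → Fin n → ℤ
  δ u v = ⟦ v ≟ u ⟧

  total : ∀ {n} → (Fin n → ℤ) → Edge n → ℤ
  total x e = x (a e) + x (b e) + x (c e)

  module _ {n} (e : Edge n) where

    a≢b : a e ≢ b e
    a≢b = Finₚ.<⇒≢ (a<b e)

    b≢c : b e ≢ c e
    b≢c = Finₚ.<⇒≢ (b<c e)

    a≢c : a e ≢ c e
    a≢c = Finₚ.<⇒≢ (Finₚ.<-trans (a<b e) (b<c e))

    -- Only products with the factor at `l` change. In an edge through `l` the other two values sum
    -- to `total x e`, because `x l` is 0.
    q-extend : ∀ x s l → x l ≡ 0ℤ →
               q (λ v → x v + s * δ l v) e ≡ q x e + ⟦ l ∈e? e ⟧ * (s * total x e)
    q-extend x s l xl≡0 with a e ≟ l | b e ≟ l | c e ≟ l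
    ... | yes refl | yes refl | _        = contradiction refl a≢b
    ... | yes refl | _        | yes refl = contradiction refl a≢c
    ... | _        | yes refl | yes refl = contradiction refl b≢c
    ... | no l≢a   | no l≢b   | no l≢c
      rewrite ⟦⟧-no {P = l ∈e e} (λ { (inj₁ p) → l≢a (sym p) ; (inj₂ (inj₁ p)) → l≢b (sym p) ; (inj₂ (inj₂ p)) →
        l≢c (sym p) }) (l ∈e? e)
      = lemma (x (a e)) (x (b e)) (x (c e)) s
      where
      lemma : ∀ x y z s → (x + s * 0ℤ) * (y + s * 0ℤ) + (y + s * 0ℤ) * (z + s * 0ℤ) + (x + s * 0ℤ) *
        (z + s * 0ℤ)
                        ≡ x * y + y * z + x * z + 0ℤ * (s * (x + y + z))
      lemma = solve-∀
    ... | yes refl | no _     | no _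
      rewrite ⟦⟧-yes {P = a e ∈e e} (inj₁ refl) (a e ∈e? e) | xl≡0
      = lemma (x (b e)) (x (c e)) s
      where
      lemma : ∀ y z s → (0ℤ + s * 1ℤ) * (y + s * 0ℤ) + (y + s * 0ℤ) * (z + s * 0ℤ) + (0ℤ + s * 1ℤ) *
        (z + s * 0ℤ)
                        ≡ 0ℤ * y + y * z + 0ℤ * z + 1ℤ * (s * (0ℤ + y + z))
      lemma = solve-∀
    ... | no _     | yes refl | no _
      rewrite ⟦⟧-yes {P = b e ∈e e} (inj₂ (inj₁ refl)) (b e ∈e? e) | xl≡0
      = lemma (x (a e)) (x (c e)) s
      where
      lemma : ∀ x z s → (x + s * 0ℤ) * (0ℤ + s * 1ℤ) + (0ℤ + s * 1ℤ) * (z + s * 0ℤ) + (x + s * 0ℤ) *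
        (z + s * 0ℤ)
                        ≡ x * 0ℤ + 0ℤ * z + x * z + 1ℤ * (s * (x + 0ℤ + z))
      lemma = solve-∀
    ... | no _     | no _     | yes refl
      rewrite ⟦⟧-yes {P = c e ∈e e} (inj₂ (inj₂ refl)) (c e ∈e? e) | xl≡0
      = lemma (x (a e)) (x (b e)) s
      where
      lemma : ∀ x y s → (x + s * 0ℤ) * (y + s * 0ℤ) + (y + s * 0ℤ) * (0ℤ + s * 1ℤ) + (x + s * 0ℤ) *
        (0ℤ + s * 1ℤ)
                        ≡ x * y + y * 0ℤ + x * 0ℤ + 1ℤ * (s * (x + y + 0ℤ))
      lemma = solve-∀

  -- Partial sign vectors, good sets and stars

  module _ {n} (H : Graph3 n) where

    Q-extend : ∀ x s l → x l ≡ 0ℤ →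
               Q H (λ v → x v + s * δ l v) ≡ Q H x + ∑ (edges H) (λ e → ⟦ l ∈e? e ⟧ * (s * total x e))
    Q-extend x s l xl≡0 = trans (∑-cong (edges H) (λ e → q-extend e x s l xl≡0)) (∑-+ _ _ (edges H))

    Q-zero : Q H (λ _ → 0ℤ) ≡ 0ℤ
    Q-zero = trans (∑-const 0ℤ (edges H)) (*-zeroʳ (+ m H))

    Q-δ : ∀ l → Q H (δ l) ≡ 0ℤ
    Q-δ l = begin
      Q H (δ l)
        ≡⟨ ∑-cong (edges H) (q-cong {x = δ l} (λ v → sym (trans (+-identityˡ _) (*-identityˡ _)))) ⟩
      Q H (λ v → 0ℤ + 1ℤ * δ l v)                 ≡⟨ Q-extend (λ _ → 0ℤ) 1ℤ l refl ⟩
      Q H (λ _ → 0ℤ) + ∑ (edges H) (λ e → ⟦ l ∈e? e ⟧ * 0ℤ)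
        ≡⟨ cong₂ _+_ Q-zero (trans (∑-cong (edges H) (λ e → *-zeroʳ ⟦ l ∈e? e ⟧)) Q-zero) ⟩
      0ℤ ∎
      where open ≡-Reasoning

    Adj : Fin n → Fin n → Set
    Adj u w = Any (λ e → u ∈e e × w ∈e e) (edges H)

    adj? : ∀ u w → Dec (Adj u w)
    adj? u w = Any.any? (λ e → (u ∈e? e) ×-dec (w ∈e? e)) (edges H)

    Adj-sym : ∀ {u w} → Adj u w → Adj w u
    Adj-sym = Any.map λ { (p , r) → r , p }

    Separated : List (Fin n) → List (Fin n) → Set
    Separated X Y = ∀ {u w} → u ∈ X → w ∈ Y → ¬ Adj u w

    -- Extension by 0 lets sign vectors on disjoint sets be added, and makes `Q` see only the pairs
    -- inside `A`.
    record Signing (A : List (Fin n)) : Set where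
      field
        val : Fin n → ℤ
        on  : ∀ {v} → v ∈ A → Unit (val v)
        off : ∀ {v} → v ∉ A → val v ≡ 0ℤ
    open Signing public

    Signing-resp-↭ : ∀ {A B} → A ↭ B → Signing A → Signing B
    Signing-resp-↭ p σ = record
      { val = val σ
      ; on  = λ v∈B → on σ (∈-resp-↭ (↭-sym p) v∈B)
      ; off = λ v∉B → off σ (v∉B ∘ ∈-resp-↭ p)
      }

    empty-signing : Signing []
    empty-signing = record { val = λ _ → 0ℤ ; on = λ () ; off = λ _ → refl }

    singleton : ∀ v → Signing [ v ]
    singleton v = record
      { val = δ v
      ; on  = λ { (here refl) → inj₁ (⟦⟧-yes refl (v ≟ v)) }
      ; off = λ u∉ → ⟦⟧-no (u∉ ∘ here) (_ ≟ v)
      }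

    open import Data.List.Membership.DecPropositional (_≟_ {n}) using (_∈?_)

    merge : ∀ {A B} → Signing A → Signing B → Disjoint A B → ∀ {s} → Unit s → Signing (A ++ B)
    merge {A} {B} σ τ disj {s} unit = record { val = λ v → val σ v + s * val τ v ; on = on′ ; off = off′ }
      where
      on′ : ∀ {v} → v ∈ A ++ B → Unit (val σ v + s * val τ v)
      on′ {v} v∈ with ∈-++⁻ A v∈
      ... | inj₁ v∈A = subst Unit (sym (trans (cong (λ z → val σ v + s * z) (off τ (λ v∈B → disj (v∈A , v∈B))))
                         (trans (cong (_+_ (val σ v)) (*-zeroʳ s)) (+-identityʳ _)))) (on σ v∈A)
      ... | inj₂ v∈B = subst Unit (sym (trans (cong (λ z → z + s * val τ v) (off σ (λ v∈A → disj (v∈A , v∈B))))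
                         (+-identityˡ _))) (unit-* unit (on τ v∈B))
      off′ : ∀ {v} → v ∉ A ++ B → val σ v + s * val τ v ≡ 0ℤ
      off′ {v} v∉ rewrite off σ (v∉ ∘ ∈-++⁺ˡ) | off τ (v∉ ∘ ∈-++⁺ʳ A) = trans (+-identityˡ _) (*-zeroʳ s)

    -- The invariant `-2 Q ≥ |A|`. It is additive in `A`, so it passes to disjoint unions
    -- (`Good-++`).
    Good : List (Fin n) → Set
    Good A = Σ (Signing A) λ σ → + length A + (Q H (val σ) + Q H (val σ)) ≤ 0ℤ

    Good-resp-↭ : ∀ {A B} → A ↭ B → Good A → Good B
    Good-resp-↭ p (σ , bound) = Signing-resp-↭ p σ ,
      subst (λ k → + k + (Q H (val σ) + Q H (val σ)) ≤ 0ℤ) (↭-length p) bound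

    Good-[] : Good []
    Good-[] = empty-signing , ≤-reflexive (trans (+-identityˡ _) (cong₂ _+_ Q-zero Q-zero))

    ++-signing : ∀ {A B} (σ : Signing A) (τ : Signing B) → Disjoint A B →
                 Σ (Signing (A ++ B)) λ ρ → Q H (val ρ) ≤ Q H (val σ) + Q H (val τ)
    ++-signing σ τ disj with s , unit , le ← join H (val σ) (val τ) = merge σ τ disj unit , le

    Good-++ : ∀ {A B} → Good A → Good B → Disjoint A B → Good (A ++ B)
    Good-++ {A} {B} (σ , bσ) (τ , bτ) disj with ρ , le ← ++-signing σ τ disj =
      ρ , ≤-trans (+-monoʳ-≤ (+ length (A ++ B)) (+-mono-≤ le le))
            (≤-trans (≤-reflexive (trans (cong (λ k →
              + k + ((Q H (val σ) + Q H (val τ)) + (Q H (val σ) + Q H (val τ)))) (length-++ A))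
              (lemma (+ length A) (+ length B) (Q H (val σ)) (Q H (val τ))))) (+-mono-≤ bσ bτ))
      where
      lemma : ∀ i j s t → (i + j) + ((s + t) + (s + t)) ≡ (i + (s + s)) + (j + (t + t))
      lemma = solve-∀

    -- Adjacency to the centre and nonadjacency of the leaves enter only when a leaf is added, in
    -- `Star-∷`. Fixing the sign of the centre as 1 lets each new leaf take the sign -1.
    Star : Fin n → List (Fin n) → Set
    Star v L = Σ (Signing (v ∷ L)) λ σ → val σ v ≡ 1ℤ × + length L + Q H (val σ) ≤ 0ℤ

    Star-[] : ∀ v → Star v []
    Star-[] v = singleton v , ⟦⟧-yes refl (v ≟ v) , ≤-reflexive (trans (+-identityˡ _) (Q-δ v))

    -- Give `u` the sign -1. An edge through `u` contains no earlier leaf, so its other values are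
    -- 0, or 1 at `v`: no such edge raises `Q`, and an edge through both `u` and `v` lowers it by at
    -- least 1.
    Star-∷ : ∀ {v L u} → u ∉ v ∷ L → Adj v u → Separated L [ u ] → Star v L → Star v (u ∷ L)
    Star-∷ {v} {L} {u} u∉ adj sep (σ , σv≡1 , bound) = σ′ , σ′v≡1 , bound′
      where
      x = val σ
      disj : Disjoint (v ∷ L) [ u ]
      disj (p , here refl) = u∉ p
      σ′ : Signing (v ∷ u ∷ L)
      σ′ = Signing-resp-↭ (↭-trans (shift u (v ∷ L) []) (↭-swap u v (++-identityʳ L)))
        (merge σ (singleton u) disj (inj₂ refl))
      σ′v≡1 : x v + -1ℤ * δ u v ≡ 1ℤ
      σ′v≡1 rewrite σv≡1 | ⟦⟧-no (λ v≡u → u∉ (here (sym v≡u))) (v ≟ u) = refl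
      xu≡0 = off σ u∉
      nonneg : ∀ {e w} → e ∈ edges H → u ∈e e → w ∈e e → 0ℤ ≤ x w
      nonneg {e} {w} e∈ u∈e w∈e with w ∈? (v ∷ L)
      ... | yes (here refl) = ≤-trans (+≤+ z≤n) (≤-reflexive (sym σv≡1))
      ... | yes (there w∈L) = contradiction (lose e∈ (w∈e , u∈e)) (sep w∈L (here refl))
      ... | no w∉ = ≤-reflexive (sym (off σ w∉))
      total-nonneg : ∀ {e} → e ∈ edges H → u ∈e e → 0ℤ ≤ total x e
      total-nonneg e∈ u∈e = +-mono-≤ (+-mono-≤ (nonneg e∈ u∈e (inj₁ refl))
        (nonneg e∈ u∈e (inj₂ (inj₁ refl)))) (nonneg e∈ u∈e (inj₂ (inj₂ refl)))
      1≤xv : 1ℤ ≤ x v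
      1≤xv = ≤-reflexive (sym σv≡1)
      total-positive : ∀ {e} → e ∈ edges H → u ∈e e → v ∈e e → 1ℤ ≤ total x e
      total-positive e∈ u∈e (inj₁ refl)        = +-mono-≤ (+-mono-≤ 1≤xv (nonneg e∈ u∈e (inj₂ (inj₁ refl))))
        (nonneg e∈ u∈e (inj₂ (inj₂ refl)))
      total-positive e∈ u∈e (inj₂ (inj₁ refl)) = +-mono-≤ (+-mono-≤ (nonneg e∈ u∈e (inj₁ refl)) 1≤xv)
        (nonneg e∈ u∈e (inj₂ (inj₂ refl)))
      total-positive e∈ u∈e (inj₂ (inj₂ refl)) = +-mono-≤
        (+-mono-≤ (nonneg e∈ u∈e (inj₁ refl)) (nonneg e∈ u∈e (inj₂ (inj₁ refl)))) 1≤xv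
      gain : Edge n → ℤ
      gain e = ⟦ u ∈e? e ⟧ * total x e
      gain-nonneg : ∀ {e} → e ∈ edges H → 0ℤ ≤ gain e
      gain-nonneg {e} e∈ with u ∈e? e
      ... | yes u∈e = ≤-trans (total-nonneg e∈ u∈e) (≤-reflexive (sym (*-identityˡ _)))
      ... | no _    = ≤-refl
      1≤gain : 1ℤ ≤ ∑ (edges H) gain
      1≤gain with e , e∈ , v∈e , u∈e ← find adj =
        ∑-positive gain (edges H) gain-nonneg e∈
          (≤-trans (total-positive e∈ u∈e v∈e) (≤-reflexive
            (sym (trans (cong (_* total x e) (⟦⟧-yes u∈e (u ∈e? e))) (*-identityˡ _)))))
      Qσ′ : Q H (val σ′) ≡ Q H x - ∑ (edges H) gain
      Qσ′ = trans (Q-extend x -1ℤ u xu≡0) (cong (_+_ (Q H x))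
        (trans (∑-cong (edges H) (λ e → lemma ⟦ u ∈e? e ⟧ (total x e)))
          (trans (∑-* -1ℤ gain (edges H)) (-1*i≡-i _))))
        where
        lemma : ∀ i j → i * (-1ℤ * j) ≡ -1ℤ * (i * j)
        lemma = solve-∀
      bound′ : + length (u ∷ L) + Q H (val σ′) ≤ 0ℤ
      bound′ = ≤-trans (≤-reflexive (trans (cong (_+_ (+ length (u ∷ L))) Qσ′)
        (lemma (+ length L) (Q H x) (∑ (edges H) gain)))) (+-mono-≤ bound (i≤j⇒i-j≤0 1≤gain))
        where
        lemma : ∀ l q g → (1ℤ + l) + (q - g) ≡ (l + q) + (1ℤ - g)
        lemma = solve-∀

    -- With at least one leaf, the number of vertices, leaves plus 1, is at most twice the number of
    -- leaves, hence at most `-2 Q`.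
    Star⇒Good : ∀ {v u L} → Star v (u ∷ L) → Good (v ∷ u ∷ L)
    Star⇒Good {v} {u} {L} (σ , _ , bound) = σ , ≤-lin
      (+-mono-≤ (+-mono-≤ bound bound) (+≤+ (z≤n {length L}))) (lemma (+ length L) (Q H (val σ)))
      where
      lemma : ∀ l q → (0ℤ + 0ℤ + l) - (((1ℤ + l) + q) + ((1ℤ + l) + q) + 0ℤ) ≡ 0ℤ - (1ℤ + (1ℤ + l) + (q + q))
      lemma = solve-∀

    -- The search and its invariant

    module ++-Solver = CMSolver (++-commutativeMonoid {A = Fin n})
    open ++-Solver using (_⊕_; _⊜_) renaming (solve to ++-solve)

    -- The outcome of a depth-first search from v that may only enter R, where L collects leaf
    -- children of v still to be put into the star at v.  Distinct subtrees of a
    -- depth-first search tree are not adjacent, which is why these stars are induced.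
    record Explored (v : Fin n) (L R : List (Fin n)) : Set where
      field
        visited   : List (Fin n)
        rest      : List (Fin n)
        split     : R ↭ visited ++ rest
        separated : Separated (v ∷ visited) rest
        good      : Good (v ∷ L ++ visited) ⊎ (L ≡ [] × Good visited)
    open Explored

    module _ {v u L R R₁} (uniq : Unique (v ∷ L ++ R)) (R↭ : R ↭ u ∷ R₁) (child : Explored u [] R₁) where

      private
        A₁ = visited child
        R₁′ = rest child

      module _ {L′} (subtree : Explored v L′ R₁′) where
        private
          A₂ = visited subtree
          R′ = rest subtree

        R↭′ : R ↭ u ∷ A₁ ++ A₂ ++ R′
        R↭′ = ↭-trans R↭ (↭-prep u (↭-trans (split child) (++⁺ˡ A₁ (split subtree))))

        split′ : R ↭ (u ∷ A₁ ++ A₂) ++ R′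
        split′ = ↭-trans R↭′ (++-solve 4 (λ u x y z →
          u ⊕ (x ⊕ (y ⊕ z)) ⊜ (u ⊕ (x ⊕ y)) ⊕ z) ↭-refl [ u ] A₁ A₂ R′)

        -- The child search closed off `u ∷ A₁` from all of `R₁′`, which contains `R′`; the resumed
        -- search at `v` closed off `v` and `A₂`.
        separated′ : Separated (v ∷ (u ∷ A₁ ++ A₂)) R′
        separated′ (here refl) w∈         = separated subtree (here refl) w∈
        separated′ (there w′∈) w∈ with ∈-++⁻ (u ∷ A₁) w′∈
        ... | inj₁ w′∈uA₁ = separated child w′∈uA₁ (∈-resp-↭ (↭-sym (split subtree)) (∈-++⁺ʳ A₂ w∈))
        ... | inj₂ w′∈A₂  = separated subtree (there w′∈A₂) w∈

      -- The subtree of `u` is covered without `v`, so it is simply united with whatever the resumed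
      -- search at `v` covers.
      attach-covered : Good (u ∷ A₁) → Explored v L R₁′ → Explored v L R
      attach-covered good₁ subtree = record
        { visited = u ∷ A₁ ++ A₂ ; rest = R′ ; split = split′ subtree ; separated = separated′ subtree ; good = good′ (good subtree) }
        where
        A₂ = visited subtree
        R′ = rest subtree
        disj : Disjoint (v ∷ L ++ A₂) (u ∷ A₁)
        disj (p , r) = Unique⇒Disjoint (v ∷ L ++ A₂) (Unique-resp-↭ (↭-trans (++⁺ˡ (v ∷ L) (R↭′ subtree))
          (++-solve 5 (λ v u x y z → v ⊕ (u ⊕ (x ⊕ (y ⊕ z))) ⊜ (v ⊕ y) ⊕ ((u ⊕ x) ⊕ z)) ↭-refl
            (v ∷ L) [ u ] A₁ A₂ R′)) uniq) (p , ∈-++⁺ˡ r)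
        good′ : Good (v ∷ L ++ A₂) ⊎ (L ≡ [] × Good A₂) →
          Good (v ∷ L ++ (u ∷ A₁ ++ A₂)) ⊎ (L ≡ [] × Good (u ∷ A₁ ++ A₂))
        good′ (inj₁ g) = inj₁ (Good-resp-↭ (++-solve 3 (λ v x y → (v ⊕ y) ⊕ x ⊜ v ⊕ (x ⊕ y)) ↭-refl (v ∷ L)
          (u ∷ A₁) A₂) (Good-++ g good₁ disj))
        good′ (inj₂ (L≡[] , g)) = inj₂ (L≡[] , Good-++ good₁ g λ { (p , r) → disj (there (∈-++⁺ʳ L r) , p) })

      -- The child search left `u` itself uncovered. The resumed search carries `u` as a pending
      -- leaf, so the star at `v` covers it.
      attach-leaf : Good A₁ → Explored v (u ∷ L) R₁′ → Explored v L R
      attach-leaf good₁ subtree = record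
        { visited = u ∷ A₁ ++ A₂ ; rest = R′ ; split = split′ subtree ; separated = separated′ subtree ; good = inj₁ (good′ (good subtree)) }
        where
        A₂ = visited subtree
        R′ = rest subtree
        disj : Disjoint (v ∷ u ∷ L ++ A₂) A₁
        disj (p , r) = Unique⇒Disjoint (v ∷ u ∷ L ++ A₂) (Unique-resp-↭ (↭-trans (++⁺ˡ (v ∷ L) (R↭′ subtree))
          (++-solve 6 (λ v l u x y z → (v ⊕ l) ⊕ (u ⊕ (x ⊕ (y ⊕ z))) ⊜ (v ⊕ (u ⊕ (l ⊕ y))) ⊕
            (x ⊕ z)) ↭-refl [ v ] L [ u ] A₁ A₂ R′)) uniq) (p , ∈-++⁺ˡ r)
        good′ : Good (v ∷ u ∷ L ++ A₂) ⊎ (u ∷ L ≡ [] × Good A₂) → Good (v ∷ L ++ (u ∷ A₁ ++ A₂))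
        -- The other alternative is impossible: it would make the nonempty leaf list `u ∷ L` empty.
        good′ (inj₁ g) = Good-resp-↭ (++-solve 5
          (λ v l u x y → (v ⊕ (u ⊕ (l ⊕ y))) ⊕ x ⊜ (v ⊕ l) ⊕ ((u ⊕ x) ⊕ y)) ↭-refl [ v ] L [ u ] A₁ A₂)
            (Good-++ g good₁ disj)

    -- Search from an unvisited neighbour `u` of `v`, then resume at `v` on the vertices that
    -- remain. If `u` comes back covered, its subtree is set aside as good; otherwise `u` joins the
    -- leaves of the star at `v`. The fuel `k` bounds the length of `R`, and both recursive calls
    -- have lost `u`.
    explore : ∀ k v L R → length R ℕ.≤ k → Unique (v ∷ L ++ R) → Separated L R → Star v L → Explored v L R
    explore k v L R len uniq sep star with Any.any? (adj? v) R
    -- No neighbour of `v` is left, so its star is final. With no leaves, `v` stays uncovered and is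
    -- offered to its parent as a leaf.
    explore k v L R len uniq sep star | no ¬adj = record
      { visited = [] ; rest = R ; split = ↭-refl
      ; separated = λ { (here refl) w∈ adj → ¬adj (lose w∈ adj) }
      ; good = good-star L star }
      where
      good-star : ∀ L → Star v L → Good (v ∷ L ++ []) ⊎ (L ≡ [] × Good [])
      good-star []      _    = inj₂ (refl , Good-[])
      good-star (u ∷ L) star = inj₁ (Good-resp-↭ (↭-sym (++-identityʳ (v ∷ u ∷ L))) (Star⇒Good star))
    explore zero    v L (_ ∷ _) () uniq sep star | yes _
    explore (suc k) v L R len uniq sep star | yes some
      with u , u∈R , adj ← find some
      with R₁ , R↭ ← ∈⇒↭ u∈R = continue (good child)
      where
      len₁ : length R₁ ℕ.≤ k
      len₁ = ℕₚ.≤-pred (subst (ℕ._≤ suc k) (↭-length R↭) len)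
      uniq-uR₁ : Unique (v ∷ L ++ u ∷ R₁)
      uniq-uR₁ = Unique-resp-↭ (++⁺ˡ (v ∷ L) R↭) uniq
      child : Explored u [] R₁
      child = explore k u [] R₁ len₁ (Unique-++⁻ʳ (v ∷ L) uniq-uR₁) (λ ()) (Star-[] u)
      A₁ = visited child
      R₁′ = rest child
      len₁′ : length R₁′ ℕ.≤ k
      len₁′ = ℕₚ.≤-trans (subst (length R₁′ ℕ.≤_) (sym (trans (↭-length (split child)) (length-++ A₁)))
        (ℕₚ.m≤n+m _ _)) len₁
      ∈R₁′⇒∈R : ∀ {w} → w ∈ R₁′ → w ∈ R
      ∈R₁′⇒∈R w∈ = ∈-resp-↭ (↭-sym R↭) (there (∈-resp-↭ (↭-sym (split child)) (∈-++⁺ʳ A₁ w∈)))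
      uniq₁ : Unique (v ∷ L ++ u ∷ A₁ ++ R₁′)
      uniq₁ = Unique-resp-↭ (++⁺ˡ (v ∷ L) (↭-trans R↭ (↭-prep u (split child)))) uniq
      continue : Good (u ∷ A₁) ⊎ ([] ≡ [] × Good A₁) → Explored v L R
      continue (inj₁ g) = attach-covered uniq R↭ child g
        (explore k v L R₁′ len₁′
          (Unique-++⁻ʳ (u ∷ A₁) (Unique-resp-↭ (++-solve 3 (λ v x y → v ⊕ (x ⊕ y) ⊜ x ⊕ (v ⊕ y)) ↭-refl
            (v ∷ L) (u ∷ A₁) R₁′) uniq₁))
          (λ p r → sep p (∈R₁′⇒∈R r)) star)
      continue (inj₂ (_ , g)) = attach-leaf uniq R↭ child g
        (explore k v (u ∷ L) R₁′ len₁′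
          (Unique-++⁻ʳ A₁ (Unique-resp-↭ (++-solve 5
            (λ v l u x y → (v ⊕ l) ⊕ (u ⊕ (x ⊕ y)) ⊜ x ⊕
              (v ⊕ (u ⊕ (l ⊕ y)))) ↭-refl [ v ] L [ u ] A₁ R₁′) uniq₁))
          -- Future leaves at `v` come from `R₁′`, which the finished child search has separated
          -- from `u`; this keeps the star induced.
          (λ { (here refl) r → separated child (here refl) r ; (there p) r → sep p (∈R₁′⇒∈R r) })
          (Star-∷ (λ u∈ → Unique⇒Disjoint (v ∷ L) uniq-uR₁ (u∈ , here refl)) adj
            (λ { p (here refl) → sep p u∈R }) star))

  -- The two lower bounds in the number of vertices

  length≥2 : ∀ {A : Set} {y z : A} {xs} → y ∈ xs → z ∈ xs → y ≢ z → 2 ℕ.≤ length xs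
  length≥2 (here refl) (here refl) y≢z = contradiction refl y≢z
  length≥2 (here refl) (there (here _))  y≢z = s≤s (s≤s z≤n)
  length≥2 (here refl) (there (there _)) y≢z = s≤s (s≤s z≤n)
  length≥2 (there (here _))  z∈ y≢z = s≤s (s≤s z≤n)
  length≥2 (there (there _)) z∈ y≢z = s≤s (s≤s z≤n)

  others : ∀ {n} {v : Fin n} (e : Edge n) → v ∈e e →
           ∃ λ y → ∃ λ z → y ∈e e × z ∈e e × y ≢ v × z ≢ v × y ≢ z
  others e (inj₁ refl)        = b e , c e , inj₂ (inj₁ refl) , inj₂
    (inj₂ refl) , a≢b e ∘ sym , a≢c e ∘ sym , b≢c e
  others e (inj₂ (inj₁ refl)) = a e , c e , inj₁ refl , inj₂ (inj₂ refl) , a≢b e , b≢c e ∘ sym , a≢c e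
  others e (inj₂ (inj₂ refl)) = a e , b e , inj₁ refl , inj₂ (inj₁ refl) , a≢c e , b≢c e , a≢b e

  module _ {n} (H : Graph3 n) where

    open Explored

    signing-cut : ∀ {A} (σ : Signing H A) → (∀ v → v ∈ A) → ∃ λ f → surplus H f ≡ - Q H (val σ)
    signing-cut σ all = cut-of H (val σ) (λ v → on σ (all v))

    -- An uncovered root is joined as a single vertex, whose form is 0. This does not increase `Q`,
    -- but the root is then not counted in the bound.
    cover : ∀ {v R} → Unique (v ∷ R) → (E : Explored H v [] R) →
            Σ (Signing H (v ∷ visited E)) λ σ → + length (visited E) + (Q H (val σ) + Q H (val σ)) ≤ 0ℤ
    cover {v} {R} uniq E with good E
    ... | inj₁ (σ , bound) = σ , ≤-trans (+-monoˡ-≤ (Q H (val σ) + Q H (val σ))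
      (+≤+ (ℕₚ.n≤1+n (length (visited E))))) bound
    ... | inj₂ (_ , σ , bound) = ρ , ≤-trans (+-monoʳ-≤ (+ length (visited E)) (+-mono-≤ Qρ≤Qσ Qρ≤Qσ)) bound
      where
      disj : Disjoint [ v ] (visited E)
      disj (here refl , p) = Unique[x∷xs]⇒x∉xs uniq (∈-resp-↭ (↭-sym (split E)) (∈-++⁺ˡ p))
      merged = ++-signing H (singleton H v) σ disj
      ρ = proj₁ merged
      Qρ≤Qσ : Q H (val ρ) ≤ Q H (val σ)
      Qρ≤Qσ = ≤-trans (proj₂ merged) (≤-reflexive
        (trans (cong (λ z → z + Q H (val σ)) (Q-δ H v)) (+-identityˡ _)))

    module _ {v R} (E : Explored H v [] R) where

      visited-or-rest : ∀ {w} → w ∈ v ∷ R → w ∈ v ∷ visited E ⊎ w ∈ rest E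
      visited-or-rest w∈ = ∈-++⁻ (v ∷ visited E) (∈-resp-↭ (↭-prep v (split E)) w∈)

      visited-closed : ∀ {w z} → w ∈ v ∷ visited E → z ∈ v ∷ R → Adj H w z → z ∈ v ∷ visited E
      visited-closed w∈ z∈ adj with visited-or-rest z∈
      ... | inj₁ p = p
      ... | inj₂ p = contradiction adj (separated E w∈ p)

    module _ {v R} (uniq : Unique (v ∷ R)) (E : Explored H v [] R) (σ : Signing H (v ∷ visited E))
             (σ-bound : + length (visited E) + (Q H (val σ) + Q H (val σ)) ≤ 0ℤ) where

      private
        uniq′ : Unique ((v ∷ visited E) ++ rest E)
        uniq′ = Unique-resp-↭ (↭-prep v (split E)) uniq

        disj : Disjoint (v ∷ visited E) (rest E)
        disj = Unique⇒Disjoint (v ∷ visited E) uniq′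

        length-split : length R ≡ length (visited E) ℕ.+ length (rest E)
        length-split = trans (↭-length (split E)) (length-++ (visited E))

      -- A path from the root cannot leave the visited set, so connectivity forces `rest` to be
      -- empty and every vertex other than the root to be counted.
      connected-component : Connected H → (∀ w → w ∈ v ∷ R) → ∃ λ f → + length R ≤ surplus H f + surplus H f
      connected-component conn all = proj₁ cut ,
        ≤-trans (≤-lin (+-mono-≤ σ-bound (+≤+ length≤))
          (lemma (+ length (visited E)) (+ length R) (Q H (val σ))))
          (≤-reflexive (sym (cong₂ _+_ (proj₂ cut) (proj₂ cut))))
        where
        reach-visited : ∀ {u w} → Reach H u w → u ∈ v ∷ visited E → w ∈ v ∷ visited E
        reach-visited here u∈ = u∈
        reach-visited (step e e∈ u∈e w∈e r) u∈ =
          reach-visited r (visited-closed E u∈ (all _) (lose e∈ (u∈e , w∈e)))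
        everywhere : ∀ w → w ∈ v ∷ visited E
        everywhere w = reach-visited (conn v w) (here refl)
        cut = signing-cut σ everywhere
        rest-empty : ∀ xs → (∀ {w} → w ∉ xs) → length xs ≡ 0
        rest-empty []       _  = refl
        rest-empty (x ∷ xs) ∉xs = contradiction (here refl) ∉xs
        length≤ : length R ℕ.≤ length (visited E)
        length≤ = ℕₚ.≤-reflexive (trans length-split (trans
          (cong (ℕ._+_ (length (visited E))) (rest-empty (rest E) (λ w∈ → disj (everywhere _ , w∈))))
            (ℕₚ.+-identityʳ _)))
        lemma : ∀ l k q → (0ℤ + l) - ((l + (q + q)) + k) ≡ (- q + - q) - k
        lemma = solve-∀

      -- The visited vertices and the root form a whole component, and an edge at the root supplies
      -- two visited vertices. The induction hypothesis, passed as `recursive`, handles the other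
      -- components, and the two sign vectors are joined.
      add-component : NoIsolated H → (∀ {w z} → w ∈ v ∷ R → Adj H w z → z ∈ v ∷ R) →
        (length (rest E) ℕ.≤ length R → Unique (rest E) → (∀ {w z} → w ∈ rest E → Adj H w z → z ∈ rest E) →
          Σ (Signing H (rest E)) λ τ → + length (rest E) + + 3 * Q H (val τ) ≤ 0ℤ) →
        Σ (Signing H (v ∷ R)) λ ρ → + length (v ∷ R) + + 3 * Q H (val ρ) ≤ 0ℤ
      add-component iso closed recursive = combine
        (recursive (subst (length (rest E) ℕ.≤_) (sym length-split) (ℕₚ.m≤n+m _ _))
          (Unique-++⁻ʳ (v ∷ visited E) uniq′) rest-closed)
        where
        rest-closed : ∀ {w z} → w ∈ rest E → Adj H w z → z ∈ rest E
        rest-closed w∈ adj with visited-or-rest E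
          (closed (there (∈-resp-↭ (↭-sym (split E)) (∈-++⁺ʳ (visited E) w∈))) adj)
        ... | inj₁ p = contradiction (Adj-sym H adj) (separated E p w∈)
        ... | inj₂ p = p
        others-visited : ∀ {e y} → e ∈ edges H → v ∈e e → y ∈e e → y ≢ v → y ∈ visited E
        others-visited e∈ v∈e y∈e y≢v
          with adj ← lose e∈ (v∈e , y∈e)
          with visited-closed E (here refl) (closed (here refl) adj) adj
        ... | here y≡v = contradiction y≡v y≢v
        ... | there p  = p
        2≤visited : 2 ℕ.≤ length (visited E)
        2≤visited with e , e∈ , v∈e ← find (iso v)
                  with y , z , y∈e , z∈e , y≢v , z≢v , y≢z ← others e v∈e =
          length≥2 (others-visited e∈ v∈e y∈e y≢v) (others-visited e∈ v∈e z∈e z≢v) y≢z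
        -- With t ≥ 2 vertices besides v, the bound t + 2 Q ≤ 0 gives t + 1 + 3 Q ≤ 0.
        σ-bound′ : 1ℤ + + length (visited E) + + 3 * Q H (val σ) ≤ 0ℤ
        σ-bound′ = *-cancelˡ-≤-pos _ _ (+ 2) (≤-lin (+-mono-≤ (*-monoˡ-≤-nonNeg (+ 3) σ-bound) (+≤+ 2≤visited))
          (lemma (+ length (visited E)) (Q H (val σ))))
          where
          lemma : ∀ t q → (+ 3 * 0ℤ + t) - (+ 3 * (t + (q + q)) + + 2) ≡ + 2 * 0ℤ - + 2 * (1ℤ + t + + 3 * q)
          lemma = solve-∀
        lemma : ∀ i j s t r → (0ℤ + 0ℤ + + 3 * (s + t)) - (((1ℤ + i + + 3 * s) + (j + + 3 * t)) + + 3 * r)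
          ≡ 0ℤ - ((1ℤ + (i + j)) + + 3 * r)
        lemma = solve-∀
        combine : (Σ (Signing H (rest E)) λ τ → + length (rest E) + + 3 * Q H (val τ) ≤ 0ℤ) →
                  Σ (Signing H (v ∷ R)) λ ρ → + length (v ∷ R) + + 3 * Q H (val ρ) ≤ 0ℤ
        combine (τ , τ-bound) with ρ , le ← ++-signing H σ τ disj =
          Signing-resp-↭ H (↭-sym (↭-prep v (split E))) ρ ,
          subst (λ k → + suc k + + 3 * Q H (val ρ) ≤ 0ℤ) (sym length-split)
            (≤-lin (+-mono-≤ (+-mono-≤ σ-bound′ τ-bound) (*-monoˡ-≤-nonNeg (+ 3) le))
              (lemma (+ length (visited E)) (+ length (rest E)) (Q H (val σ)) (Q H (val τ)) (Q H (val ρ))))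

    connected-surplus : Connected H → ∃ λ f → + n - 1ℤ ≤ surplus H f + surplus H f
    connected-surplus conn = by-size n refl
      where
      by-size : ∀ k → k ≡ n → ∃ λ f → + n - 1ℤ ≤ surplus H f + surplus H f
      -- Without vertices there is no root to start from, and the bound reads -1 ≤ 0.
      by-size zero refl with f , eq ← signing-cut (empty-signing H) (λ ()) = f , ≤-trans -≤+
        (≤-reflexive (sym (cong₂ _+_ surplus≡0 surplus≡0)))
        where
        surplus≡0 = trans eq (cong -_ (Q-zero H))
      by-size (suc k) refl = conclude (explore H _ zero [] _ ℕₚ.≤-refl (allFin⁺ n) (λ ()) (Star-[] H zero))
        where
        conclude : Explored H zero [] (tabulate suc) → ∃ λ f → + n - 1ℤ ≤ surplus H f + surplus H f
        conclude E = map₂ (≤-trans (≤-reflexive (cong +_ (sym (length-tabulate {n = k} suc)))))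
          (connected-component (allFin⁺ n) E (proj₁ covered) (proj₂ covered) conn ∈-allFin)
          where covered = cover (allFin⁺ n) E

    -- Removes one component at a time. Closure of `U` under adjacency keeps the component of each
    -- of its vertices inside `U`; `k` is fuel.
    components : NoIsolated H → ∀ k U → length U ℕ.≤ k → Unique U → (∀ {w z} → w ∈ U → Adj H w z → z ∈ U) →
                 Σ (Signing H U) λ σ → + length U + + 3 * Q H (val σ) ≤ 0ℤ
    components iso k []      len uniq closed = empty-signing H , ≤-reflexive
      (trans (+-identityˡ _) (cong (_*_ (+ 3)) (Q-zero H)))
    components iso (suc k) (v ∷ R) (s≤s len) uniq closed
      with E ← explore H _ v [] R ℕₚ.≤-refl uniq (λ ()) (Star-[] H v)
      with σ , bound ← cover uniq E =
      add-component uniq E σ bound iso closed (λ rest≤ → components iso k (rest E) (ℕₚ.≤-trans rest≤ len))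

    no-isolated-surplus : NoIsolated H → ∃ λ f → + n ≤ + 3 * surplus H f
    no-isolated-surplus iso = conclude (components iso _ (allFin n) ℕₚ.≤-refl (allFin⁺ n) (λ _ _ → ∈-allFin _))
      where
      lemma : ∀ n q → 0ℤ - (n + + 3 * q) ≡ + 3 * (- q) - n
      lemma = solve-∀
      conclude : (Σ (Signing H (allFin n)) λ σ → + length (allFin n) + + 3 * Q H (val σ) ≤ 0ℤ) → ∃ λ f → + n
        ≤ + 3 * surplus H f
      conclude (σ , bound) = map₂
        (λ eq → subst₂ (λ k s → + k ≤ + 3 * s) (length-tabulate {n = n} id) (sym eq)
          (≤-lin bound (lemma (+ length (allFin n)) (Q H (val σ)))))
        (signing-cut σ ∈-allFin)

  -- Strong colourings

  module Involution {k} (σ : Fin k → Fin k) (invol : ∀ i → σ (σ i) ≡ i) where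

    -- Each orbit of `σ` is named by its smaller element `low`; `parity` is 1 there, fixed points
    -- included, and -1 at the larger element.
    low-of : ∀ i → Dec (i Fin.≤ σ i) → Fin k
    low-of i (yes _) = i
    low-of i (no _)  = σ i

    parity-of : ∀ i → Dec (i Fin.≤ σ i) → ℤ
    parity-of i (yes _) = 1ℤ
    parity-of i (no _)  = -1ℤ

    low : Fin k → Fin k
    low i = low-of i (i Finₚ.≤? σ i)

    parity : Fin k → ℤ
    parity i = parity-of i (i Finₚ.≤? σ i)

    parity-unit : ∀ i → Unit (parity i)
    parity-unit i with i Finₚ.≤? σ i
    ... | yes _ = inj₁ refl
    ... | no _  = inj₂ refl

    low-parity : ∀ i → (i Fin.≤ σ i × low i ≡ i × parity i ≡ 1ℤ) ⊎ (σ i Fin.< i × low i ≡ σ i × parity i ≡ -1ℤ)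
    low-parity i with i Finₚ.≤? σ i
    ... | yes le = inj₁ (le , refl , refl)
    ... | no nle = inj₂ (ℕₚ.≰⇒> nle , refl , refl)

    -- Distinct elements have the same `low` exactly when `σ` exchanges them, and then their
    -- parities are opposite.
    paired-product : ∀ i j → i ≢ j → ⟦ low i ≟ low j ⟧ * (parity i * parity j) ≡ - ⟦ σ i ≟ j ⟧
    paired-product i j i≢j with low i ≟ low j | σ i ≟ j | low-parity i | low-parity j
    ... | yes _  | yes σi≡j | inj₁ (_ , _ , pi) | inj₂ (_ , _ , pj) rewrite pi | pj = refl
    ... | yes _  | yes σi≡j | inj₂ (_ , _ , pi) | inj₁ (_ , _ , pj) rewrite pi | pj = refl
    ... | yes eq | _        | inj₁ (_ , li , _) | inj₁ (_ , lj , _) = contradiction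
      (trans (sym li) (trans eq lj)) i≢j
    ... | yes eq | _        | inj₂ (_ , li , _) | inj₂ (_ , lj , _) =
      contradiction (trans (sym (invol i)) (trans (cong σ (trans (sym li) (trans eq lj))) (invol j))) i≢j
    ... | yes eq | no σi≢j  | inj₁ (_ , li , _) | inj₂ (_ , lj , _) =
      contradiction (trans (cong σ (trans (sym li) (trans eq lj))) (invol j)) σi≢j
    ... | yes eq | no σi≢j  | inj₂ (_ , li , _) | inj₁ (_ , lj , _) = contradiction
      (trans (sym li) (trans eq lj)) σi≢j
    ... | no _   | no _     | _ | _ = refl
    ... | no neq | yes refl | inj₁ (i≤ , _ , _) | inj₁ (j≤ , _ , _) =
      contradiction (Finₚ.≤-antisym i≤ (subst (σ i Fin.≤_) (invol i) j≤)) i≢j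
    ... | no neq | yes refl | inj₁ (_ , li , _) | inj₂ (_ , lj , _) = contradiction
      (trans li (sym (trans lj (invol i)))) neq
    ... | no neq | yes refl | inj₂ (_ , li , _) | inj₁ (_ , lj , _) = contradiction (trans li (sym lj)) neq
    ... | no neq | yes refl | inj₂ (i> , _ , _) | inj₂ (j> , _ , _) =
      contradiction i> (ℕₚ.<-asym (subst (Fin._< σ i) (invol i) j>))

  -- For fixed c, the map sending i to c - i modulo k is an involution, and any two residues are
  -- exchanged by one of these k reflections: this is the factorisation of the complete graph on
  -- k vertices into k matchings.
  module _ {k : ℕ} where

    -- Congruence of `i + j` to `c` modulo `k`, without division: the sum is below `2 k`, so it can
    -- only be `c` or `c + k`.
    SumsTo : Fin k → Fin k → Fin k → Set
    SumsTo c i j = toℕ i ℕ.+ toℕ j ≡ toℕ c ⊎ toℕ i ℕ.+ toℕ j ≡ toℕ c ℕ.+ k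

    SumsTo-sym : ∀ {c i j} → SumsTo c i j → SumsTo c j i
    SumsTo-sym {i = i} {j} (inj₁ eq) = inj₁ (trans (ℕₚ.+-comm (toℕ j) (toℕ i)) eq)
    SumsTo-sym {i = i} {j} (inj₂ eq) = inj₂ (trans (ℕₚ.+-comm (toℕ j) (toℕ i)) eq)

    SumsTo-unique : ∀ {c i j j′} → SumsTo c i j → SumsTo c i j′ → j ≡ j′
    SumsTo-unique {c} {i} {j} {j′} = go
      where
      same : ∀ {s} → toℕ i ℕ.+ toℕ j ≡ s → toℕ i ℕ.+ toℕ j′ ≡ s → j ≡ j′
      same p r = Finₚ.toℕ-injective (ℕₚ.+-cancelˡ-≡ (toℕ i) _ _ (trans p (sym r)))
      -- Solutions for the sums `c` and `c + k` would differ by `k`, which is too much for two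
      -- residues.
      shifted : ∀ {l l′ : Fin k} → toℕ i ℕ.+ toℕ l ≡ toℕ c → toℕ i ℕ.+ toℕ l′ ≢ toℕ c ℕ.+ k
      shifted {l} {l′} p r = ℕₚ.<⇒≱ (Finₚ.toℕ<n l′) (subst (k ℕ.≤_)
        (ℕₚ.+-cancelˡ-≡ (toℕ i) _ _ (trans (sym (ℕₚ.+-assoc (toℕ i) (toℕ l) k))
          (trans (cong (ℕ._+ k) p) (sym r)))) (ℕₚ.m≤n+m k (toℕ l)))
      go : SumsTo c i j → SumsTo c i j′ → j ≡ j′
      go (inj₁ p) (inj₁ r) = same p r
      go (inj₂ p) (inj₂ r) = same p r
      go (inj₁ p) (inj₂ r) = contradiction r (shifted {j} {j′} p)
      go (inj₂ p) (inj₁ r) = contradiction p (shifted {j′} {j} r)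

    reflection : ∀ c i → ∃ (SumsTo c i)
    reflection c i with toℕ i ℕ.≤? toℕ c
    ... | yes i≤c = Fin.fromℕ< (ℕₚ.≤-<-trans (ℕₚ.m∸n≤m (toℕ c) (toℕ i)) (Finₚ.toℕ<n c)) ,
      inj₁ (trans (cong (toℕ i ℕ.+_) (Finₚ.toℕ-fromℕ< _)) (ℕₚ.m+[n∸m]≡n i≤c))
    ... | no i≰c = Fin.fromℕ< bound , inj₂ (trans (cong (toℕ i ℕ.+_) (Finₚ.toℕ-fromℕ< bound)) cancel)
      where
      cancel : toℕ i ℕ.+ (toℕ c ℕ.+ k ℕ.∸ toℕ i) ≡ toℕ c ℕ.+ k
      cancel = ℕₚ.m+[n∸m]≡n (ℕₚ.≤-trans (ℕₚ.<⇒≤ (Finₚ.toℕ<n i)) (ℕₚ.m≤n+m k (toℕ c)))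
      bound : toℕ c ℕ.+ k ℕ.∸ toℕ i ℕ.< k
      bound = ℕₚ.+-cancelˡ-< (toℕ i) _ _ (subst (ℕ._< toℕ i ℕ.+ k) (sym cancel) (ℕₚ.+-monoˡ-< k (ℕₚ.≰⇒> i≰c)))

    reflect : Fin k → Fin k → Fin k
    reflect c i = proj₁ (reflection c i)

    reflect-involutive : ∀ c i → reflect c (reflect c i) ≡ i
    reflect-involutive c i = SumsTo-unique {c} {reflect c i} (proj₂ (reflection c (reflect c i)))
      (SumsTo-sym {c} {i} (proj₂ (reflection c i)))

    -- The centre is `i + j` reduced modulo `k`.
    reflect-transitive : ∀ i j → ∃ λ c → reflect c i ≡ j
    reflect-transitive i j = proj₁ centre , SumsTo-unique {proj₁ centre} {i}
      (proj₂ (reflection (proj₁ centre) i)) (proj₂ centre)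
      where
      centre : ∃ λ c → SumsTo c i j
      centre with toℕ i ℕ.+ toℕ j ℕ.<? k
      ... | yes lt = Fin.fromℕ< lt , inj₁ (sym (Finₚ.toℕ-fromℕ< lt))
      ... | no nlt = Fin.fromℕ< bound , inj₂ (sym (trans (cong (ℕ._+ k) (Finₚ.toℕ-fromℕ< bound)) cancel))
        where
        cancel : toℕ i ℕ.+ toℕ j ℕ.∸ k ℕ.+ k ≡ toℕ i ℕ.+ toℕ j
        cancel = ℕₚ.m∸n+n≡m (ℕₚ.≮⇒≥ nlt)
        bound : toℕ i ℕ.+ toℕ j ℕ.∸ k ℕ.< k
        bound = ℕₚ.+-cancelʳ-< k _ _ (subst (ℕ._< k ℕ.+ k) (sym cancel)
          (ℕₚ.+-mono-< (Finₚ.toℕ<n i) (Finₚ.toℕ<n j)))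

  -- Merging colours until any two meet in an edge

  module _ {n} (H : Graph3 n) where

    HasColour : ∀ {k} → (Fin n → Fin k) → Fin k → Edge n → Set
    HasColour col i e = i ≡ col (a e) ⊎ i ≡ col (b e) ⊎ i ≡ col (c e)

    Joined : ∀ {k} → (Fin n → Fin k) → Fin k → Fin k → Set
    Joined col i j = Any (λ e → HasColour col i e × HasColour col j e) (edges H)

    joined? : ∀ {k} (col : Fin n → Fin k) i j → Dec (Joined col i j)
    joined? col i j = Any.any? (λ e → has? i e ×-dec has? j e) (edges H)
      where
      has? : ∀ i e → Dec (HasColour col i e)
      has? i e = (i ≟ col (a e)) ⊎-dec ((i ≟ col (b e)) ⊎-dec (i ≟ col (c e)))

    record Strong {k} (col : Fin n → Fin k) : Set where
      field
        ab : ∀ {e} → e ∈ edges H → col (a e) ≢ col (b e)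
        bc : ∀ {e} → e ∈ edges H → col (b e) ≢ col (c e)
        ac : ∀ {e} → e ∈ edges H → col (a e) ≢ col (c e)
    open Strong

    Complete : ∀ {k} → (Fin n → Fin k) → Set
    Complete col = ∀ {i j} → i ≢ j → Joined col i j

    -- `punchOut` deletes the colour `j` from the palette, and vertices coloured `j` take the new
    -- name of `i`.
    identify-of : ∀ {k} {i j : Fin (suc k)} → i ≢ j → ∀ x → Dec (j ≡ x) → Fin k
    identify-of i≢j x (yes _)  = Fin.punchOut (i≢j ∘ sym)
    identify-of i≢j x (no j≢x) = Fin.punchOut j≢x

    identify : ∀ {k} {i j : Fin (suc k)} → i ≢ j → Fin (suc k) → Fin k
    identify {j = j} i≢j x = identify-of i≢j x (j ≟ x)

    identify-injective : ∀ {k} {i j : Fin (suc k)} (i≢j : i ≢ j) {x y} → x ≢ y →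
      ¬ (i ≡ x × j ≡ y) → ¬ (i ≡ y × j ≡ x) → identify i≢j x ≢ identify i≢j y
    identify-injective {i = i} {j} i≢j {x} {y} x≢y ¬xy ¬yx eq with j ≟ x | j ≟ y
    ... | yes refl | yes refl = x≢y refl
    ... | yes refl | no j≢y   = ¬yx (Finₚ.punchOut-injective (i≢j ∘ sym) j≢y eq , refl)
    ... | no j≢x   | yes refl = ¬xy (sym (Finₚ.punchOut-injective j≢x (i≢j ∘ sym) eq) , refl)
    ... | no j≢x   | no j≢y   = x≢y (Finₚ.punchOut-injective j≢x j≢y eq)

    -- Only `i` and `j` fall together, and no edge contains both of these colours.
    identify-strong : ∀ {k} {col : Fin n → Fin (suc k)} {i j} (i≢j : i ≢ j) → ¬ Joined col i j →
                      Strong col → Strong (identify i≢j ∘ col)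
    identify-strong i≢j ¬joined strong = record
      { ab = λ e∈ → identify-injective i≢j (ab strong e∈)
          (λ { (p , r) → ¬joined (lose e∈ (inj₁ p , inj₂ (inj₁ r))) })
            (λ { (p , r) → ¬joined (lose e∈ (inj₂ (inj₁ p) , inj₁ r)) })
      ; bc = λ e∈ → identify-injective i≢j (bc strong e∈)
          (λ { (p , r) → ¬joined (lose e∈ (inj₂ (inj₁ p) , inj₂ (inj₂ r))) })
            (λ { (p , r) → ¬joined (lose e∈ (inj₂ (inj₂ p) , inj₂ (inj₁ r))) })
      ; ac = λ e∈ → identify-injective i≢j (ac strong e∈)
          (λ { (p , r) → ¬joined (lose e∈ (inj₁ p , inj₂ (inj₂ r))) })
            (λ { (p , r) → ¬joined (lose e∈ (inj₂ (inj₂ p) , inj₁ r)) })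
      }

    -- While two colours share no edge they are merged, which costs one colour each time; a single
    -- colour is trivially complete.
    complete-colouring : ∀ k (col : Fin n → Fin (suc k)) → Strong col →
                         ∃ λ k′ → Σ (Fin n → Fin (suc k′)) λ col′ → Strong col′ × Complete col′
    complete-colouring k col strong
      with Finₚ.any? (λ i → Finₚ.any? (λ j → ¬? (i ≟ j) ×-dec ¬? (joined? col i j)))
    complete-colouring zero    col strong | yes (zero , zero , 0≢0 , _) = contradiction refl 0≢0
    complete-colouring (suc k) col strong | yes (i , j , i≢j , ¬joined) =
      complete-colouring k (identify i≢j ∘ col) (identify-strong i≢j ¬joined strong)
    complete-colouring k       col strong | no none = k , col , strong ,
      λ {i} {j} i≢j → decidable-stable (joined? col i j) (λ ¬joined → none (i , j , i≢j , ¬joined))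

    colour-pairs : ∀ {k} → (Fin n → Fin k) → List (Edge n) → List (Fin k × Fin k)
    colour-pairs col []       = []
    colour-pairs col (e ∷ es) =
      (col (a e) , col (b e)) ∷ (col (b e) , col (a e)) ∷ (col (b e) , col (c e)) ∷
      (col (c e) , col (b e)) ∷ (col (a e) , col (c e)) ∷ (col (c e) , col (a e)) ∷ colour-pairs col es

    ∈-colour-pairs : ∀ {k} (col : Fin n → Fin k) {i j es} → i ≢ j →
                     Any (λ e → HasColour col i e × HasColour col j e) es → (i , j) ∈ colour-pairs col es
    ∈-colour-pairs col i≢j (here (inj₁ refl        , inj₁ refl))        = contradiction refl i≢j
    ∈-colour-pairs col i≢j (here (inj₁ refl        , inj₂ (inj₁ refl))) = here refl
    ∈-colour-pairs col i≢j (here (inj₂ (inj₁ refl) , inj₁ refl))        = there (here refl)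
    ∈-colour-pairs col i≢j (here (inj₂ (inj₁ refl) , inj₂ (inj₁ refl))) = contradiction refl i≢j
    ∈-colour-pairs col i≢j (here (inj₂ (inj₁ refl) , inj₂ (inj₂ refl))) = there (there (here refl))
    ∈-colour-pairs col i≢j (here (inj₂ (inj₂ refl) , inj₂ (inj₁ refl))) = there (there (there (here refl)))
    ∈-colour-pairs col i≢j (here (inj₁ refl        , inj₂ (inj₂ refl))) = there
      (there (there (there (here refl))))
    ∈-colour-pairs col i≢j (here (inj₂ (inj₂ refl) , inj₁ refl))        = there
      (there (there (there (there (here refl)))))
    ∈-colour-pairs col i≢j (here (inj₂ (inj₂ refl) , inj₂ (inj₂ refl))) = contradiction refl i≢j
    ∈-colour-pairs col i≢j (there p) = there (there (there (there (there (there (∈-colour-pairs col i≢j p))))))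

    length-colour-pairs : ∀ {k} (col : Fin n → Fin k) es → length (colour-pairs col es) ≡ length es ℕ.* 6
    length-colour-pairs col []       = refl
    length-colour-pairs col (e ∷ es) = cong (6 ℕ.+_) (length-colour-pairs col es)

    -- The `(k + 1) k` ordered pairs of distinct colours inject into the `6 m` ordered pairs listed
    -- edge by edge: each is sent to a position where it occurs, and the position determines the
    -- pair.
    colours-bound : ∀ {k} {col : Fin n → Fin (suc k)} → Complete col → suc k ℕ.* k ℕ.≤ m H ℕ.* 6
    colours-bound {k} {col} complete = subst (suc k ℕ.* k ℕ.≤_) (length-colour-pairs col (edges H))
      (Finₚ.injective⇒≤ {f = Any.index ∘ occurrence} injective)
      where
      pair : Fin (suc k ℕ.* k) → Fin (suc k) × Fin (suc k)
      -- Quotient, remainder and `punchIn` enumerate the ordered pairs with distinct entries.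
      pair x with i , j ← Fin.remQuot {suc k} k x = i , Fin.punchIn i j
      occurrence : ∀ x → pair x ∈ colour-pairs col (edges H)
      occurrence x = ∈-colour-pairs col (Finₚ.punchInᵢ≢i _ _ ∘ sym) (complete (Finₚ.punchInᵢ≢i _ _ ∘ sym))
      remQuot-injective : ∀ x y → Fin.remQuot {suc k} k x ≡ Fin.remQuot k y → x ≡ y
      remQuot-injective x y eq = trans (sym (Finₚ.combine-remQuot {suc k} k x))
        (trans (cong (λ { (i , j) → Fin.combine i j }) eq) (Finₚ.combine-remQuot {suc k} k y))
      pair-injective : ∀ p r → (proj₁ p , Fin.punchIn (proj₁ p) (proj₂ p))
        ≡ (proj₁ r , Fin.punchIn (proj₁ r) (proj₂ r)) → p ≡ r
      pair-injective (i , j) (i′ , j′) eq with refl ← cong proj₁ eq = cong (i ,_)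
        (Finₚ.punchIn-injective i j j′ (cong proj₂ eq))
      injective : ∀ {x y} → Any.index (occurrence x) ≡ Any.index (occurrence y) → x ≡ y
      injective {x} {y} eq = remQuot-injective x y
        (pair-injective (Fin.remQuot {suc k} k x) (Fin.remQuot {suc k} k y)
        (trans (lookup-index (occurrence x)) (trans (cong (lookup (colour-pairs col (edges H))) eq)
          (sym (lookup-index (occurrence y))))))

    -- Flipping the signs of whole blocks of vertices

    module _ {k} (β : Fin n → Fin k) (τ : Fin n → ℤ) (τ-unit : ∀ v → Unit (τ v)) where

      block : Fin k → Fin n → ℤ
      block t v = ⟦ β v ≟ t ⟧ * τ v

      -- The blocks are added one at a time, and `join` decides for each whether to negate it.
      join-blocks : ∀ ts → Unique ts → Σ (Fin n → ℤ) λ x →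
        (∀ {v} → β v ∈ ts → Unit (x v)) × (∀ {v} → β v ∉ ts → x v ≡ 0ℤ) × Q H x ≤ ∑ ts (λ t → Q H (block t))
      join-blocks []       _ = (λ _ → 0ℤ) , (λ ()) , (λ _ → refl) , ≤-reflexive (Q-zero H)
      join-blocks (t ∷ ts) uniq@(_ ∷ uniq′)
        with x , on , off , le ← join-blocks ts uniq′
        with s , unit , le′ ← join H x (block t) = (λ v → x v + s * block t v) , on′ , off′ ,
          ≤-trans le′ (≤-trans (≤-reflexive (+-comm (Q H x) _)) (+-monoʳ-≤ (Q H (block t)) le))
        where
        outside : ∀ {v} → β v ≢ t → x v + s * block t v ≡ x v
        outside {v} β≢t rewrite ⟦⟧-no β≢t (β v ≟ t) = trans (cong (_+_ (x v)) (*-zeroʳ s)) (+-identityʳ (x v))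
        on′ : ∀ {v} → β v ∈ t ∷ ts → Unit (x v + s * block t v)
        on′ {v} (here refl) = subst Unit (sym (trans
          (cong₂ (λ i j → i + s * (j * τ v)) (off (Unique[x∷xs]⇒x∉xs uniq)) (⟦⟧-yes refl (β v ≟ β v)))
          (trans (+-identityˡ _) (cong (s *_) (*-identityˡ (τ v)))))) (unit-* unit (τ-unit v))
        on′ {v} (there β∈)  = subst Unit (sym (outside {v} λ β≡t →
          Unique[x∷xs]⇒x∉xs uniq (subst (_∈ ts) β≡t β∈))) (on β∈)
        off′ : ∀ {v} → β v ∉ t ∷ ts → x v + s * block t v ≡ 0ℤ
        off′ {v} β∉ = trans (outside {v} (β∉ ∘ here)) (off (β∉ ∘ there))

      within : Fin n → Fin n → ℤ
      within u w = ⟦ β u ≟ β w ⟧ * (τ u * τ w)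

      -- A block contributes only if it contains both vertices, so at most one term survives.
      ∑-block : ∀ u w → ∑ (allFin k) (λ t → block t u * block t w) ≡ within u w
      ∑-block u w = trans (∑-cong (allFin k) (λ t → lemma ⟦ β u ≟ t ⟧ ⟦ β w ≟ t ⟧ (τ u) (τ w)))
        (trans (∑-allFin-indicator (λ t → ⟦ β w ≟ t ⟧ * (τ u * τ w)) (β u))
          (cong (λ z → z * (τ u * τ w)) (⟦⟧-sym (β w ≟ β u) (β u ≟ β w))))
        where
        lemma : ∀ i j s t → (i * s) * (j * t) ≡ i * (j * (s * t))
        lemma = solve-∀
        ⟦⟧-sym : ∀ {i j : Fin k} (d : Dec (i ≡ j)) (d′ : Dec (j ≡ i)) → ⟦ d ⟧ ≡ ⟦ d′ ⟧
        ⟦⟧-sym (yes p) d′ = sym (⟦⟧-yes (sym p) d′)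
        ⟦⟧-sym (no ¬p) d′ = sym (⟦⟧-no (¬p ∘ sym) d′)

      ∑-blocks : ∑ (allFin k) (λ t → Q H (block t)) ≡
                 ∑ (edges H) (λ e → within (a e) (b e) + within (b e) (c e) + within (a e) (c e))
      ∑-blocks = trans (∑-swap (λ t → q (block t)) (allFin k) (edges H)) (∑-cong (edges H) λ e →
        trans (∑-+₃ _ _ _ (allFin k)) (cong₂ _+_ (cong₂ _+_ (∑-block (a e) (b e)) (∑-block (b e) (c e)))
          (∑-block (a e) (c e))))

      -- Derandomises flipping every block by an independent fair coin: pairs from different blocks
      -- average to 0, and only pairs inside a block remain.
      align : Σ (Fin n → ℤ) λ x → (∀ v → Unit (x v)) ×
              Q H x ≤ ∑ (edges H) (λ e → within (a e) (b e) + within (b e) (c e) + within (a e) (c e))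
      align with x , on , _ , le ← join-blocks (allFin k) (allFin⁺ k) = x ,
        (λ v → on (∈-allFin (β v))) , ≤-trans le (≤-reflexive ∑-blocks)

    module _ {k} (col : Fin n → Fin k) (strong : Strong col) where

      matched : (Fin k → Fin k) → Edge n → ℤ
      matched σ e = ⟦ σ (col (a e)) ≟ col (b e) ⟧ + ⟦ σ (col (b e)) ≟ col (c e) ⟧ + ⟦ σ (col (a e)) ≟ col
        (c e) ⟧

      -- The blocks are the unions of the colour classes `i` and `σ i`, with opposite signs on the
      -- two classes. Vertices of an edge have distinct colours, so two of them share a block only
      -- if `σ` exchanges their colours, and this contributes -1 to the form.
      matching-surplus : ∀ σ → (∀ i → σ (σ i) ≡ i) → ∃ λ f → ∑ (edges H) (matched σ) ≤ surplus H f
      matching-surplus σ invol = conclude (align β τ τ-unit)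
        where
        open Involution σ invol
        β = low ∘ col
        τ = parity ∘ col
        τ-unit = parity-unit ∘ col
        crossing : ∀ u w → col u ≢ col w → within β τ τ-unit u w ≡ - ⟦ σ (col u) ≟ col w ⟧
        crossing u w = paired-product (col u) (col w)
        crossings : Edge n → ℤ
        crossings e = within β τ τ-unit (a e) (b e) + within β τ τ-unit (b e) (c e) + within β τ τ-unit (a e)
          (c e)
        lemma : ∀ i j l → - i + - j + - l ≡ -1ℤ * (i + j + l)
        lemma = solve-∀
        ∑-crossings : ∑ (edges H) crossings ≤ - ∑ (edges H) (matched σ)
        ∑-crossings = ≤-trans (∑-mono (edges H) λ {e} e∈ → ≤-reflexive (trans
            (cong₂ _+_ (cong₂ _+_ (crossing (a e) (b e) (ab strong e∈))
              (crossing (b e) (c e) (bc strong e∈))) (crossing (a e) (c e) (ac strong e∈)))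
            (lemma ⟦ σ (col (a e)) ≟ col (b e) ⟧ ⟦ σ (col (b e)) ≟ col (c e) ⟧ ⟦ σ (col (a e)) ≟ col (c e) ⟧)))
          (≤-reflexive (trans (∑-* -1ℤ (matched σ) (edges H)) (-1*i≡-i _)))
        conclude : (Σ (Fin n → ℤ) λ x → (∀ v → Unit (x v)) × Q H x ≤ ∑ (edges H) crossings) →
                   ∃ λ f → ∑ (edges H) (matched σ) ≤ surplus H f
        conclude (x , unit , le) = map₂
          (λ eq → ≤-trans (≤-reflexive (sym (neg-involutive _)))
            (≤-trans (neg-mono-≤ (≤-trans le ∑-crossings)) (≤-reflexive (sym eq))))
          (cut-of H x unit)

      matched-nonneg : ∀ σ e → 0ℤ ≤ matched σ e
      matched-nonneg σ e = +-mono-≤ (+-mono-≤ (⟦⟧-nonneg (σ (col (a e)) ≟ col (b e)))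
        (⟦⟧-nonneg (σ (col (b e)) ≟ col (c e))))
        (⟦⟧-nonneg (σ (col (a e)) ≟ col (c e)))

    -- Every one of the `3 m` vertex pairs in edges is matched by some reflection of the `k + 1`
    -- colours, so the best reflection matches at least the average number.
    strong-surplus : ∀ {k} (col : Fin n → Fin (suc k)) → Strong col → ∃ λ f → 0ℤ ≤ surplus H f × + 3 * + m H
      ≤ + suc k * surplus H f
    strong-surplus {k} col strong = conclude (average≤maximum weight zero (tabulate suc))
      where
      weight : Fin (suc k) → ℤ
      weight c = ∑ (edges H) (matched col strong (reflect c))
      total-weight : + 3 * + m H ≤ ∑ (allFin (suc k)) weight
      total-weight = begin
        + 3 * + m H                                                          ≡⟨ *-comm (+ 3) (+ m H) ⟩
        + m H * + 3                                                          ≡⟨ ∑-const (+ 3) (edges H) ⟨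
        ∑ (edges H) (λ _ → + 3)
          ≤⟨ ∑-mono (edges H) (λ {e} _ → each e) ⟩
        ∑ (edges H) (λ e → ∑ (allFin (suc k)) (λ c → matched col strong (reflect c) e))
          ≡⟨ ∑-swap (λ e c → matched col strong (reflect c) e) (edges H) (allFin (suc k)) ⟩
        ∑ (allFin (suc k)) weight                                            ∎
        where
        open ≤-Reasoning
        once : ∀ i j → 1ℤ ≤ ∑ (allFin (suc k)) (λ c → ⟦ reflect c i ≟ j ⟧)
        once i j with c , eq ← reflect-transitive i j =
          ∑-positive (λ c → ⟦ reflect c i ≟ j ⟧) (allFin (suc k)) (λ {c} _ → ⟦⟧-nonneg (reflect c i ≟ j))
            (∈-allFin c)
            (≤-reflexive (sym (⟦⟧-yes eq (reflect c i ≟ j))))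
        each : ∀ e → + 3 ≤ ∑ (allFin (suc k)) (λ c → matched col strong (reflect c) e)
        each e = ≤-trans (+-mono-≤ (+-mono-≤ (once (col (a e)) (col (b e))) (once (col (b e)) (col (c e))))
          (once (col (a e)) (col (c e))))
          (≤-reflexive (sym (∑-+₃ (λ r → ⟦ reflect r (col (a e)) ≟ col (b e) ⟧)
            (λ r → ⟦ reflect r (col (b e)) ≟ col (c e) ⟧)
            (λ r → ⟦ reflect r (col (a e)) ≟ col (c e) ⟧) (allFin (suc k)))))
      conclude : (∃ λ c → ∑ (allFin (suc k)) weight ≤ + length (allFin (suc k)) * weight c) → _
      conclude (c , le) = map₂
        (λ w≤ → ≤-trans (∑-nonneg _ (edges H) (λ {e} _ → matched-nonneg col strong (reflect c) e)) w≤ ,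
          ≤-trans total-weight (≤-trans le (≤-trans
            (≤-reflexive (cong (λ l → + l * weight c) (length-tabulate {n = suc k} id)))
            (*-monoˡ-≤-nonNeg (+ suc k) w≤))))
        (matching-surplus col strong (reflect c) (reflect-involutive c))

    -- Write `s` for the surplus and let there be `k + 1` colours. Then
    -- `(k + 1) k ≤ 6 m ≤ 2 (k + 1) s` gives `k ≤ 2 s`, whence `3 m ≤ (k + 1) s ≤ s (2 s + 1)`.
    triple-bound : ∃ λ f → 0ℤ ≤ surplus H f × + 3 * + m H ≤ surplus H f * (+ 2 * surplus H f + 1ℤ)
    triple-bound = conclude (complete-colouring n Fin.inject₁ start)
      where
      -- All vertices start with different colours; the one spare colour makes the palette nonempty
      -- even when `n` is 0.
      start : Strong Fin.inject₁
      start = record { ab = λ {e} _ → a≢b e ∘ Finₚ.inject₁-injective ; bc = λ {e} _ →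
        b≢c e ∘ Finₚ.inject₁-injective ; ac = λ {e} _ → a≢c e ∘ Finₚ.inject₁-injective }
      module _ {k} {col : Fin n → Fin (suc k)} (complete : Complete col) {p : ℤ} (0≤p : 0ℤ ≤ p)
        (3m≤ : + 3 * + m H ≤ + suc k * p) where
        few-colours : + k ≤ + 2 * p
        few-colours = *-cancelˡ-≤-pos _ _ (+ suc k) (begin
          + suc k * + k       ≡⟨ pos-* (suc k) k ⟨
          + (suc k ℕ.* k)     ≤⟨ +≤+ (colours-bound complete) ⟩
          + (m H ℕ.* 6)       ≡⟨ pos-* (m H) 6 ⟩
          + m H * + 6         ≡⟨ six (+ m H) ⟩
          + 2 * (+ 3 * + m H) ≤⟨ *-monoˡ-≤-nonNeg (+ 2) 3m≤ ⟩
          + 2 * (+ suc k * p) ≡⟨ swap (+ suc k) p ⟩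
          + suc k * (+ 2 * p) ∎)
          where
          open ≤-Reasoning
          six : ∀ i → i * + 6 ≡ + 2 * (+ 3 * i)
          six = solve-∀
          swap : ∀ i p → + 2 * (i * p) ≡ i * (+ 2 * p)
          swap = solve-∀
        quadratic : + 3 * + m H ≤ p * (+ 2 * p + 1ℤ)
        quadratic = begin
          + 3 * + m H         ≤⟨ 3m≤ ⟩
          + suc k * p         ≤⟨ *-monoʳ-≤-nonNeg p {{nonNegative 0≤p}} (+-monoʳ-≤ 1ℤ few-colours) ⟩
          (1ℤ + + 2 * p) * p  ≡⟨ commute p ⟩
          p * (+ 2 * p + 1ℤ)  ∎
          where
          open ≤-Reasoning
          commute : ∀ p → (1ℤ + + 2 * p) * p ≡ p * (+ 2 * p + 1ℤ)
          commute = solve-∀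
      conclude : (∃ λ k′ → Σ (Fin n → Fin (suc k′)) λ col′ → Strong col′ × Complete col′) → _
      conclude (k , col , strong , complete) = map₂
        (λ { (0≤p , le) → 0≤p , quadratic {col = col} complete 0≤p le }) (strong-surplus col strong)

  -- Steiner triple systems and perfect matchings

  length-filter≢0 : {A : Set} {P : A → Set} (P? : ∀ x → Dec (P x)) (xs : List A) → length (filter P? xs) ≡ 1 →
    ∃ λ x → x ∈ xs × P x
  length-filter≢0 P? xs eq with filter P? xs in found
  length-filter≢0 P? xs () | []
  ... | x ∷ _ = x , ∈-filter⁻ P? (subst (x ∈_) (sym found) (here refl))

  incidence : ∀ {n} (e : Edge n) v → ⟦ v ∈e? e ⟧ ≡ ⟦ a e ≟ v ⟧ + ⟦ b e ≟ v ⟧ + ⟦ c e ≟ v ⟧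
  incidence e v with a e ≟ v | b e ≟ v | c e ≟ v
  ... | yes refl | yes b≡a | _       = contradiction (sym b≡a) (a≢b e)
  ... | yes refl | _       | yes c≡a = contradiction (sym c≡a) (a≢c e)
  ... | _        | yes refl | yes c≡b = contradiction (sym c≡b) (b≢c e)
  ... | yes refl | no _     | no _    = ⟦⟧-yes (inj₁ refl) (v ∈e? e)
  ... | no _     | yes refl | no _    = ⟦⟧-yes (inj₂ (inj₁ refl)) (v ∈e? e)
  ... | no _     | no _     | yes refl = ⟦⟧-yes (inj₂ (inj₂ refl)) (v ∈e? e)
  ... | no a≢v   | no b≢v   | no c≢v  =
    ⟦⟧-no (λ { (inj₁ p) → a≢v (sym p) ; (inj₂ (inj₁ p)) → b≢v (sym p) ; (inj₂ (inj₂ p)) → c≢v (sym p) })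
      (v ∈e? e)

  ∑-incident : ∀ {n} (g : Fin n → ℤ) (e : Edge n) → ∑ (allFin n) (λ v → ⟦ v ∈e? e ⟧ * g v) ≡ total g e
  ∑-incident {n} g e = begin
    ∑ (allFin n) (λ v → ⟦ v ∈e? e ⟧ * g v)
      ≡⟨ ∑-cong (allFin n) (λ v → trans (cong (_* g v) (incidence e v))
        (distrib ⟦ a e ≟ v ⟧ ⟦ b e ≟ v ⟧ ⟦ c e ≟ v ⟧ (g v))) ⟩
    ∑ (allFin n) (λ v → ⟦ a e ≟ v ⟧ * g v + ⟦ b e ≟ v ⟧ * g v + ⟦ c e ≟ v ⟧ * g v)
      ≡⟨ ∑-+₃ _ _ _ (allFin n) ⟩
    ∑ (allFin n) (λ v → ⟦ a e ≟ v ⟧ * g v) + ∑ (allFin n) (λ v → ⟦ b e ≟ v ⟧ * g v) + ∑ (allFin n)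
      (λ v → ⟦ c e ≟ v ⟧ * g v)
      ≡⟨ cong₂ _+_ (cong₂ _+_ (∑-allFin-indicator g (a e)) (∑-allFin-indicator g (b e)))
        (∑-allFin-indicator g (c e)) ⟩
    total g e ∎
    where
    open ≡-Reasoning
    distrib : ∀ i j k z → (i + j + k) * z ≡ i * z + j * z + k * z
    distrib = solve-∀

  module _ {n} (H : Graph3 n) where

    degree-∑ : ∀ v → + degree H v ≡ ∑ (edges H) (λ e → ⟦ v ∈e? e ⟧)
    degree-∑ v = ∑-filter (v ∈e?_) (edges H)

    -- Double counting of incident vertex-edge pairs, with weights on both sides.
    ∑-incidences : ∀ (g : Fin n → ℤ) (h : Edge n → ℤ) →
      ∑ (allFin n) (λ v → g v * ∑ (edges H) (λ e → ⟦ v ∈e? e ⟧ * h e)) ≡ ∑ (edges H) (λ e → total g e * h e)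
    ∑-incidences g h = begin
      ∑ (allFin n) (λ v → g v * ∑ (edges H) (λ e → ⟦ v ∈e? e ⟧ * h e))
        ≡⟨ ∑-cong (allFin n) (λ v → sym (∑-* (g v) _ (edges H))) ⟩
      ∑ (allFin n) (λ v → ∑ (edges H) (λ e → g v * (⟦ v ∈e? e ⟧ * h e)))
        ≡⟨ ∑-swap (λ v e → g v * (⟦ v ∈e? e ⟧ * h e)) (allFin n) (edges H) ⟩
      ∑ (edges H) (λ e → ∑ (allFin n) (λ v → g v * (⟦ v ∈e? e ⟧ * h e)))
        ≡⟨ ∑-cong (edges H) (λ e → trans (∑-cong (allFin n) (λ v → rotate (g v) ⟦ v ∈e? e ⟧ (h e)))
             (trans (∑-* (h e) (λ v → ⟦ v ∈e? e ⟧ * g v) (allFin n))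
               (trans (cong (h e *_) (∑-incident g e)) (*-comm (h e) _)))) ⟩
      ∑ (edges H) (λ e → total g e * h e) ∎
      where
      open ≡-Reasoning
      rotate : ∀ i j k → i * (j * k) ≡ k * (j * i)
      rotate = solve-∀

    handshake : ∑ (allFin n) (λ v → + degree H v) ≡ + 3 * + m H
    handshake = begin
      ∑ (allFin n) (λ v → + degree H v)
        ≡⟨ ∑-cong (allFin n) (λ v → trans (degree-∑ v)
          (sym (trans (*-identityˡ _) (∑-cong (edges H) (λ e → *-identityʳ ⟦ v ∈e? e ⟧))))) ⟩
      ∑ (allFin n) (λ v → 1ℤ * ∑ (edges H) (λ e → ⟦ v ∈e? e ⟧ * 1ℤ))
        ≡⟨ ∑-incidences (λ _ → 1ℤ) (λ _ → 1ℤ) ⟩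
      ∑ (edges H) (λ _ → + 3)
        ≡⟨ ∑-const (+ 3) (edges H) ⟩
      + m H * + 3
        ≡⟨ *-comm (+ m H) (+ 3) ⟩
      + 3 * + m H ∎
      where open ≡-Reasoning

    matching-no-isolated : PerfectMatching H → NoIsolated H
    matching-no-isolated perfect v with e , e∈ , v∈e ← length-filter≢0 (v ∈e?_) (edges H)
      (perfect v) = lose e∈ v∈e

    -- At most all `m` edges are cut, so the surplus is at most `4 m - 3 m`, and counting degrees
    -- gives `3 m = n`.
    matching-surplus≤ : PerfectMatching H → ∀ f → + 3 * surplus H f ≤ + n
    matching-surplus≤ perfect f = ≤-trans (*-monoˡ-≤-nonNeg (+ 3) surplus≤m) (≤-reflexive 3m≡n)
      where
      surplus≤m : surplus H f ≤ + m H
      surplus≤m = ≤-lin (*-monoˡ-≤-nonNeg (+ 4) (+≤+ (length-filter (multicoloured? f) (edges H))))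
        (lemma (+ cutSize H f) (+ m H))
        where
        lemma : ∀ c m → + 4 * m - + 4 * c ≡ m - (+ 4 * c - + 3 * m)
        lemma = solve-∀
      3m≡n : + 3 * + m H ≡ + n
      3m≡n = trans (sym handshake) (trans (∑-cong (allFin n) (λ v → cong +_ (perfect v)))
        (trans (∑-allFin-const n 1ℤ) (*-identityʳ (+ n))))

    -- Steiner triple systems through their incidence matrix

    module _ (steiner : Steiner H) where

      steiner-connected : Connected H
      steiner-connected u v with u ≟ v
      ... | yes refl = here
      ... | no u≢v with e , e∈ , u∈e , v∈e ← length-filter≢0 (λ e → (u ∈e? e) ×-dec (v ∈e? e)) (edges H)
        (steiner u v u≢v) =
        step e e∈ u∈e v∈e here

      -- For the incidence matrix `N` with rows indexed by vertices, this is the entry at `u`, `v`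
      -- of `N Nᵀ = J + D - I`, where `J` is the all-ones matrix and `D` the diagonal matrix of
      -- degrees.
      codegree : ∀ u v → ∑ (edges H) (λ e → ⟦ u ∈e? e ⟧ * ⟦ v ∈e? e ⟧) ≡ 1ℤ + ⟦ u ≟ v ⟧ * (+ degree H u - 1ℤ)
      codegree u v with u ≟ v
      ... | yes refl = trans (∑-cong (edges H) (λ e → ⟦⟧-idem (u ∈e? e)))
        (trans (sym (degree-∑ u)) (lemma (+ degree H u)))
        where
        lemma : ∀ d → d ≡ 1ℤ + 1ℤ * (d - 1ℤ)
        lemma = solve-∀
      ... | no u≢v = trans (∑-cong (edges H) (λ e → sym (⟦⟧-× (u ∈e? e) (v ∈e? e))))
        (trans (sym (∑-filter (λ e → (u ∈e? e) ×-dec (v ∈e? e)) (edges H))) (cong +_ (steiner u v u≢v)))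

      -- Row `u` of `N Nᵀ` applied to the vector `y`.
      ∑-totals-at : ∀ u (y : Fin n → ℤ) → ∑ (edges H) (λ e → ⟦ u ∈e? e ⟧ * total y e)
        ≡ ∑ (allFin n) y + (+ degree H u - 1ℤ) * y u
      ∑-totals-at u y = begin
        ∑ (edges H) (λ e → ⟦ u ∈e? e ⟧ * total y e)
          ≡⟨ ∑-cong (edges H) (λ e → *-comm ⟦ u ∈e? e ⟧ _) ⟩
        ∑ (edges H) (λ e → total y e * ⟦ u ∈e? e ⟧)
          ≡⟨ ∑-incidences y (λ e → ⟦ u ∈e? e ⟧) ⟨
        ∑ (allFin n) (λ v → y v * ∑ (edges H) (λ e → ⟦ v ∈e? e ⟧ * ⟦ u ∈e? e ⟧))
          ≡⟨ ∑-cong (allFin n) (λ v → trans (cong (y v *_)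
            (trans (∑-cong (edges H) (λ e → *-comm ⟦ v ∈e? e ⟧ _)) (codegree u v)))
               (lemma (y v) ⟦ u ≟ v ⟧ (+ degree H u - 1ℤ))) ⟩
        ∑ (allFin n) (λ v → y v + (+ degree H u - 1ℤ) * (⟦ u ≟ v ⟧ * y v))
          ≡⟨ ∑-+ y _ (allFin n) ⟩
        ∑ (allFin n) y + ∑ (allFin n) (λ v → (+ degree H u - 1ℤ) * (⟦ u ≟ v ⟧ * y v))
          ≡⟨ cong (_+_ (∑ (allFin n) y)) (trans (∑-* (+ degree H u - 1ℤ) _ (allFin n))
            (cong (_*_ (+ degree H u - 1ℤ)) (∑-allFin-indicator y u))) ⟩
        ∑ (allFin n) y + (+ degree H u - 1ℤ) * y u ∎
        where
        open ≡-Reasoning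
        lemma : ∀ y i d → y * (1ℤ + i * d) ≡ y + d * (i * y)
        lemma = solve-∀

      -- Take y = 1 in ∑-totals-at.
      steiner-degree : ∀ u → + n ≡ 1ℤ + + 2 * + degree H u
      steiner-degree u = isolate (+ n) (+ degree H u)
        (trans (sym (trans (∑-cong (edges H) (λ e → *-comm ⟦ u ∈e? e ⟧ (+ 3)))
          (trans (∑-* (+ 3) _ (edges H)) (cong (_*_ (+ 3)) (sym (degree-∑ u))))))
        (trans (∑-totals-at u (λ _ → 1ℤ)) (cong₂ _+_ (trans (∑-allFin-const n 1ℤ) (*-identityʳ (+ n)))
          (*-identityʳ (+ degree H u - 1ℤ)))))
        where
        move : ∀ n d → n ≡ (n + (d - 1ℤ)) - d + 1ℤ
        move = solve-∀
        finish : ∀ d → + 3 * d - d + 1ℤ ≡ 1ℤ + + 2 * d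
        finish = solve-∀
        isolate : ∀ n d → + 3 * d ≡ n + (d - 1ℤ) → n ≡ 1ℤ + + 2 * d
        isolate n d eq = trans (move n d) (trans (cong (λ z → z - d + 1ℤ) (sym eq)) (finish d))

      -- Every pair of vertices lies in one edge, so Q is the second elementary symmetric function.
      steiner-Q : ∀ x → (∀ v → Unit (x v)) → + 2 * Q H x ≡ ∑ (allFin n) x * ∑ (allFin n) x - + n
      -- The squared edge totals are summed twice: edge by edge they give `3 m + 2 Q`, and as
      -- `xᵀ N Nᵀ x` they give `S² + 3 m - n`.
      steiner-Q x unit = isolate (∑ (allFin n) x) (+ m H) (Q H x) (+ n)
        (trans (sym squares) (trans (sym (∑-incidences x (total x))) weighted))
        where
        open ≡-Reasoning
        S = ∑ (allFin n) x
        square-unit : ∀ {z} → Unit z → z * z ≡ 1ℤ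
        square-unit (inj₁ refl) = refl
        square-unit (inj₂ refl) = refl
        expand : ∀ i j k → (i + j + k) * (i + j + k) ≡ (i * i + j * j + k * k) + + 2 * (i * j + j * k + i * k)
        expand = solve-∀
        squares : ∑ (edges H) (λ e → total x e * total x e) ≡ + m H * + 3 + + 2 * Q H x
        squares = trans (∑-cong (edges H) (λ e → trans (expand (x (a e)) (x (b e)) (x (c e)))
            (cong (λ z → z + + 2 * q x e) (cong₂ _+_
              (cong₂ _+_ (square-unit (unit (a e))) (square-unit (unit (b e)))) (square-unit (unit (c e)))))))
          (trans (∑-+ _ _ (edges H)) (cong₂ _+_ (∑-const (+ 3) (edges H)) (∑-* (+ 2) (q x) (edges H))))
        regroup : ∀ i s d → i * (s + (d - 1ℤ) * i) ≡ s * i + (d - 1ℤ) * (i * i)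
        regroup = solve-∀
        summand : ∀ u → x u * ∑ (edges H) (λ e → ⟦ u ∈e? e ⟧ * total x e) ≡ S * x u + (+ degree H u + -1ℤ)
        summand u = trans (cong (_*_ (x u)) (∑-totals-at u x)) (trans (regroup (x u) S (+ degree H u))
          (cong (_+_ (S * x u)) (trans (cong (_*_ (+ degree H u - 1ℤ)) (square-unit (unit u)))
            (*-identityʳ _))))
        weighted : ∑ (allFin n) (λ u → x u * ∑ (edges H) (λ e → ⟦ u ∈e? e ⟧ * total x e))
          ≡ S * S + (+ 3 * + m H + + n * -1ℤ)
        weighted = trans (∑-cong (allFin n) summand) (trans (∑-+ _ _ (allFin n)) (cong₂ _+_ (∑-* S x (allFin n))
          (trans (∑-+ _ _ (allFin n)) (cong₂ _+_ handshake (∑-allFin-const n -1ℤ)))))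
        move : ∀ q m → + 2 * q ≡ (m * + 3 + + 2 * q) - + 3 * m
        move = solve-∀
        finish : ∀ s m n → (s * s + (+ 3 * m + n * -1ℤ)) - + 3 * m ≡ s * s - n
        finish = solve-∀
        isolate : ∀ s m q n → m * + 3 + + 2 * q ≡ s * s + (+ 3 * m + n * -1ℤ) → + 2 * q ≡ s * s - n
        isolate s m q n eq = trans (move q m) (trans (cong (λ z → z - + 3 * m) eq) (finish s m n))

      -- At the constant vector 1 every edge contributes 3 to `Q`, and `steiner-Q` becomes the count
      -- of ordered pairs of vertices.
      steiner-size : + 6 * + m H ≡ + n * + n - + n
      steiner-size = begin
        + 6 * + m H                                     ≡⟨ lemma (+ m H) ⟩
        + 2 * (+ m H * + 3)                             ≡⟨ cong (_*_ (+ 2)) (∑-const (+ 3) (edges H)) ⟨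
        + 2 * Q H (λ _ → 1ℤ)                            ≡⟨ steiner-Q (λ _ → 1ℤ) (λ _ → inj₁ refl) ⟩
        ∑ (allFin n) (λ _ → 1ℤ) * ∑ (allFin n) (λ _ → 1ℤ) - + n
          ≡⟨ cong (λ z → z * z - + n) (trans (∑-allFin-const n 1ℤ) (*-identityʳ (+ n))) ⟩
        + n * + n - + n                                 ∎
        where
        open ≡-Reasoning
        lemma : ∀ i → + 6 * i ≡ + 2 * (i * + 3)
        lemma = solve-∀

      -- The number of vertices is odd, so the vertex signs cannot sum to 0.
      steiner-surplus≤ : 1 ℕ.≤ n → ∀ f → surplus H f + surplus H f ≤ + n - 1ℤ
      steiner-surplus≤ 1≤n f = ≤-lin (square≥1 S≢0)
        (trans (cong (λ z → z - 1ℤ) S²) (trans (lemma (Q H x) (+ n))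
          (cong (λ z → (+ n - 1ℤ) - (z + z)) (sym (surplus≡-Q H f)))))
        where
        x = spin ∘ f
        S = ∑ (allFin n) x
        add : ∀ s n → s * s ≡ (s * s - n) + n
        add = solve-∀
        S² : S * S ≡ + 2 * Q H x + + n
        S² = trans (add S (+ n)) (cong (λ z → z + + n) (sym (steiner-Q x (spin-unit ∘ f))))
        lemma : ∀ q n → (+ 2 * q + n) - 1ℤ ≡ (n - 1ℤ) - (- q + - q)
        lemma = solve-∀
        square≥1 : ∀ {s} → s ≢ 0ℤ → 1ℤ ≤ s * s
        square≥1 {+ zero}  s≢0 = contradiction refl s≢0
        square≥1 {+ suc _} _   = +≤+ (s≤s z≤n)
        square≥1 { -[1+ _ ] } _ = +≤+ (s≤s z≤n)
        -- The degree of any one vertex shows that `n = 2 d + 1` is odd.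
        d = degree H (Fin.fromℕ< 1≤n)
        odd : ∀ i → + 2 * i + 1ℤ ≢ 0ℤ
        odd (+ zero)  ()
        odd (+ suc _) ()
        odd -[1+ k ] eq rewrite ℕₚ.+-suc k (k ℕ.+ 0) = contradiction eq λ ()
        collect : ∀ q d → + 2 * (q + d) + 1ℤ ≡ + 2 * q + (1ℤ + + 2 * d)
        collect = solve-∀
        S≢0 : S ≢ 0ℤ
        S≢0 S≡0 = odd (Q H x + + d) (trans (collect (Q H x) (+ d))
          (trans (cong (_+_ (+ 2 * Q H x)) (sym (steiner-degree (Fin.fromℕ< 1≤n))))
          (trans (sym S²) (cong (λ z → z * z) S≡0))))

  -- From integers to rationals

  -- Unnormalised rationals compute without dividing by common factors, so identities carried there
  -- become identities of integers.
  fromℚᵘ-homo-+ : ∀ p r → fromℚᵘ p ℚ.+ fromℚᵘ r ≡ fromℚᵘ (p ℚᵘ.+ r)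
  fromℚᵘ-homo-+ p r = ℚₚ.toℚᵘ-injective (ℚᵘₚ.≃-trans (ℚₚ.toℚᵘ-homo-+ (fromℚᵘ p) (fromℚᵘ r))
    (ℚᵘₚ.≃-trans (ℚᵘₚ.+-cong (ℚₚ.toℚᵘ-fromℚᵘ p) (ℚₚ.toℚᵘ-fromℚᵘ r)) (ℚᵘₚ.≃-sym (ℚₚ.toℚᵘ-fromℚᵘ (p ℚᵘ.+ r)))))

  fromℚᵘ-homo-* : ∀ p r → fromℚᵘ p ℚ.* fromℚᵘ r ≡ fromℚᵘ (p ℚᵘ.* r)
  fromℚᵘ-homo-* p r = ℚₚ.toℚᵘ-injective (ℚᵘₚ.≃-trans (ℚₚ.toℚᵘ-homo-* (fromℚᵘ p) (fromℚᵘ r))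
    (ℚᵘₚ.≃-trans (ℚᵘₚ.*-cong (ℚₚ.toℚᵘ-fromℚᵘ p) (ℚₚ.toℚᵘ-fromℚᵘ r)) (ℚᵘₚ.≃-sym (ℚₚ.toℚᵘ-fromℚᵘ (p ℚᵘ.* r)))))

  fromℚᵘ-homo-neg : ∀ p → ℚ.- fromℚᵘ p ≡ fromℚᵘ (ℚᵘ.- p)
  fromℚᵘ-homo-neg p = ℚₚ.toℚᵘ-injective (ℚᵘₚ.≃-trans (ℚₚ.toℚᵘ-homo‿- (fromℚᵘ p))
    (ℚᵘₚ.≃-trans (ℚᵘₚ.-‿cong (ℚₚ.toℚᵘ-fromℚᵘ p)) (ℚᵘₚ.≃-sym (ℚₚ.toℚᵘ-fromℚᵘ (ℚᵘ.- p)))))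

  /-cross-≡ : ∀ i d j d′ → i * + suc d′ ≡ j * + suc d → i ℚ./ suc d ≡ j ℚ./ suc d′
  /-cross-≡ i d j d′ eq = ℚₚ.fromℚᵘ-cong {mkℚᵘ i d} {mkℚᵘ j d′} (*≡* eq)

  /-cross-≤ : ∀ i d j d′ → i * + suc d′ ≤ j * + suc d → i ℚ./ suc d ℚ.≤ j ℚ./ suc d′
  /-cross-≤ i d j d′ le = ℚₚ.toℚᵘ-cancel-≤ (ℚᵘₚ.≤-trans (ℚᵘₚ.≤-reflexive (ℚₚ.toℚᵘ-fromℚᵘ (mkℚᵘ i d)))
    (ℚᵘₚ.≤-trans (*≤* le) (ℚᵘₚ.≤-reflexive (ℚᵘₚ.≃-sym (ℚₚ.toℚᵘ-fromℚᵘ (mkℚᵘ j d′))))))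

  excess≡surplus/4 : ∀ {n} (H : Graph3 n) f → excess H f ≡ surplus H f ℚ./ 4
  excess≡surplus/4 H f = begin
    C ℚ.- (ℚ.fromℚᵘ (mkℚᵘ (+ 3) 3) ℚ.* M)
      ≡⟨ cong (λ z → C ℚ.- z) (fromℚᵘ-homo-* (mkℚᵘ (+ 3) 3) (mkℚᵘ (+ m H) 0)) ⟩
    C ℚ.- fromℚᵘ (mkℚᵘ (+ 3) 3 ℚᵘ.* mkℚᵘ (+ m H) 0)
      ≡⟨ cong (ℚ._+_ C) (fromℚᵘ-homo-neg (mkℚᵘ (+ 3) 3 ℚᵘ.* mkℚᵘ (+ m H) 0)) ⟩
    C ℚ.+ fromℚᵘ (ℚᵘ.- (mkℚᵘ (+ 3) 3 ℚᵘ.* mkℚᵘ (+ m H) 0))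
      ≡⟨ fromℚᵘ-homo-+ (mkℚᵘ (+ cutSize H f) 0) (ℚᵘ.- (mkℚᵘ (+ 3) 3 ℚᵘ.* mkℚᵘ (+ m H) 0)) ⟩
    fromℚᵘ (mkℚᵘ (+ cutSize H f) 0 ℚᵘ.+ ℚᵘ.- (mkℚᵘ (+ 3) 3 ℚᵘ.* mkℚᵘ (+ m H) 0))
      ≡⟨ /-cross-≡ (+ cutSize H f * + 4 + (- (+ 3 * + m H)) * + 1) 3 (surplus H f) 3
        (lemma (+ cutSize H f) (+ m H)) ⟩
    fromℚᵘ (mkℚᵘ (surplus H f) 3) ∎
    where
    open ≡-Reasoning
    C = fromℚᵘ (mkℚᵘ (+ cutSize H f) 0)
    M = fromℚᵘ (mkℚᵘ (+ m H) 0)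
    lemma : ∀ i j → (i * + 4 + (- (+ 3 * j)) * + 1) * + 4 ≡ (+ 4 * i - + 3 * j) * + 4
    lemma = solve-∀

  16z+1 : ∀ (i : ℤ) d → fromℚᵘ (mkℚᵘ (+ 16) 0) ℚ.* fromℚᵘ (mkℚᵘ i d) ℚ.+ 1ℚ
    ≡ fromℚᵘ (mkℚᵘ (+ 16) 0 ℚᵘ.* mkℚᵘ i d ℚᵘ.+ mkℚᵘ (+ 1) 0)
  16z+1 i d = trans (cong (ℚ._+ 1ℚ) (fromℚᵘ-homo-* (mkℚᵘ (+ 16) 0) (mkℚᵘ i d)))
    (fromℚᵘ-homo-+ (mkℚᵘ (+ 16) 0 ℚᵘ.* mkℚᵘ i d) (mkℚᵘ (+ 1) 0))

  square : ∀ i → (i ℚ./ 1) ℚ.* (i ℚ./ 1) ≡ (i * i) ℚ./ 1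
  square i = fromℚᵘ-homo-* (mkℚᵘ i 0) (mkℚᵘ i 0)

  /-mono-≤ : ∀ {i j} d → i ≤ j → i ℚ./ suc d ℚ.≤ j ℚ./ suc d
  /-mono-≤ {i} {j} d i≤j = /-cross-≤ i d j d (*-monoʳ-≤-nonNeg (+ suc d) i≤j)

  24m+1 : ∀ k → + (24 ℕ.* k ℕ.+ 1) ≡ + 24 * + k + 1ℤ
  24m+1 k = trans (pos-+ (24 ℕ.* k) 1) (cong (_+ 1ℤ) (pos-* 24 k))

  -- An excess of at least `(√(24 m + 1) - 1) / 16` means that `√(24 m + 1)` is at most 16 times the
  -- excess plus 1; at excess `s / 4` the latter is the integer `4 s + 1`.
  root-excess : ∀ s → ℕtoℚ 16 ℚ.* (s ℚ./ 4) ℚ.+ 1ℚ ≡ (+ 4 * s + 1ℤ) ℚ./ 1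
  root-excess s = trans (16z+1 s 3) (/-cross-≡ ((+ 16 * s) * + 1 + + 1 * + 4) 3 (+ 4 * s + 1ℤ) 0 (lemma s))
    where
    lemma : ∀ s → ((+ 16 * s) * + 1 + + 1 * + 4) * + 1 ≡ (+ 4 * s + 1ℤ) * + 4
    lemma = solve-∀

  root-steiner : ∀ i → ℕtoℚ 16 ℚ.* (i ℚ./ 8) ℚ.+ 1ℚ ≡ (+ 2 * i + 1ℤ) ℚ./ 1
  root-steiner i = trans (16z+1 i 7) (/-cross-≡ ((+ 16 * i) * + 1 + + 1 * + 8) 7 (+ 2 * i + 1ℤ) 0 (lemma i))
    where
    lemma : ∀ s → ((+ 16 * s) * + 1 + + 1 * + 8) * + 1 ≡ (+ 2 * s + 1ℤ) * + 8
    lemma = solve-∀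

  module _ {n} (H : Graph3 n) where

    -- Since `(4 s + 1)² = 8 s (2 s + 1) + 1`, eight times the quadratic bound is what is needed.
    sqrt-excess : ∀ {f} → 0ℤ ≤ surplus H f → + 3 * + m H ≤ surplus H f * (+ 2 * surplus H f + 1ℤ) →
                  √ (24 ℕ.* m H ℕ.+ 1) ≤ (ℕtoℚ 16 ℚ.* excess H f ℚ.+ 1ℚ)
    sqrt-excess {f} 0≤s 3m≤ = subst (√ (24 ℕ.* m H ℕ.+ 1) ≤_)
      (sym (trans (cong (λ z → ℕtoℚ 16 ℚ.* z ℚ.+ 1ℚ) (excess≡surplus/4 H f)) (root-excess (surplus H f))))
      (/-mono-≤ 0 (+-mono-≤ (*-monoˡ-≤-nonNeg (+ 4) 0≤s) (+≤+ (z≤n {1}))) ,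
       ℚₚ.≤-trans (/-mono-≤ 0 bound) (ℚₚ.≤-reflexive (sym (square (+ 4 * surplus H f + 1ℤ)))))
      where
      lemma : ∀ s m → + 8 * (s * (+ 2 * s + 1ℤ)) - + 8 * (+ 3 * m)
        ≡ (+ 4 * s + 1ℤ) * (+ 4 * s + 1ℤ) - (+ 24 * m + 1ℤ)
      lemma = solve-∀
      bound : + (24 ℕ.* m H ℕ.+ 1) ≤ (+ 4 * surplus H f + 1ℤ) * (+ 4 * surplus H f + 1ℤ)
      bound = ≤-trans (≤-reflexive (24m+1 (m H)))
        (≤-lin (*-monoˡ-≤-nonNeg (+ 8) 3m≤) (lemma (surplus H f) (+ m H)))

    module _ {i : ℤ} {f : Cut2 n} where

      excess≥i/8 : i ≤ surplus H f + surplus H f → i ℚ./ 8 ℚ.≤ excess H f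
      excess≥i/8 le = subst (i ℚ./ 8 ℚ.≤_) (sym (excess≡surplus/4 H f))
        (/-cross-≤ i 7 (surplus H f) 3 (≤-lin (*-monoˡ-≤-nonNeg (+ 4) le) (lemma i (surplus H f))))
        where
        lemma : ∀ i s → + 4 * (s + s) - + 4 * i ≡ s * + 8 - i * + 4
        lemma = solve-∀

      excess≤i/8 : surplus H f + surplus H f ≤ i → excess H f ℚ.≤ i ℚ./ 8
      excess≤i/8 le = subst (ℚ._≤ i ℚ./ 8) (sym (excess≡surplus/4 H f))
        (/-cross-≤ (surplus H f) 3 i 7 (≤-lin (*-monoˡ-≤-nonNeg (+ 4) le) (lemma i (surplus H f))))
        where
        lemma : ∀ i s → + 4 * i - + 4 * (s + s) ≡ i * + 4 - s * + 8
        lemma = solve-∀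

      excess≥i/12 : i ≤ + 3 * surplus H f → i ℚ./ 12 ℚ.≤ excess H f
      excess≥i/12 le = subst (i ℚ./ 12 ℚ.≤_) (sym (excess≡surplus/4 H f))
        (/-cross-≤ i 11 (surplus H f) 3 (≤-lin (*-monoˡ-≤-nonNeg (+ 4) le) (lemma i (surplus H f))))
        where
        lemma : ∀ i s → + 4 * (+ 3 * s) - + 4 * i ≡ s * + 12 - i * + 4
        lemma = solve-∀

      excess≤i/12 : + 3 * surplus H f ≤ i → excess H f ℚ.≤ i ℚ./ 12
      excess≤i/12 le = subst (ℚ._≤ i ℚ./ 12) (sym (excess≡surplus/4 H f))
        (/-cross-≤ (surplus H f) 3 i 11 (≤-lin (*-monoˡ-≤-nonNeg (+ 4) le) (lemma i (surplus H f))))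
        where
        lemma : ∀ i s → + 4 * i - + 4 * (+ 3 * s) ≡ i * + 4 - s * + 12
        lemma = solve-∀

    maximum : ∀ {z} → (∃ λ f → z ℚ.≤ excess H f) → (∀ f → excess H f ℚ.≤ z) → MaxExcessIs H z
    maximum (f , ≥z) ≤z = (f , ℚₚ.≤-antisym (≤z f) ≥z) , ≤z

    -- Both sides come from `2 n - 1`: it equals `16 (n - 1) / 8 + 1`, and its square is
    -- `4 (n² - n) + 1 = 24 m + 1`.
    steiner-sqrt : 1 ℕ.≤ n → + 6 * + m H ≡ + n * + n - + n →
                   IsSqrt (24 ℕ.* m H ℕ.+ 1) (ℕtoℚ 16 ℚ.* ((+ n - + 1) ℚ./ 8) ℚ.+ 1ℚ)
    steiner-sqrt 1≤n size = subst (IsSqrt (24 ℕ.* m H ℕ.+ 1)) (sym (root-steiner (+ n - + 1)))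
      (/-mono-≤ 0 (+-mono-≤ (*-monoˡ-≤-nonNeg (+ 2) (i≤j⇒0≤j-i (+≤+ 1≤n))) (+≤+ (z≤n {1}))) ,
       trans (square (+ 2 * (+ n - + 1) + 1ℤ)) (cong (ℚ._/ 1) (sym equation)))
      where
      24=4*6 : ∀ m → + 24 * m + 1ℤ ≡ + 4 * (+ 6 * m) + 1ℤ
      24=4*6 = solve-∀
      lemma : ∀ n → + 4 * (n * n - n) + 1ℤ ≡ (+ 2 * (n - + 1) + 1ℤ) * (+ 2 * (n - + 1) + 1ℤ)
      lemma = solve-∀
      equation : + (24 ℕ.* m H ℕ.+ 1) ≡ (+ 2 * (+ n - + 1) + 1ℤ) * (+ 2 * (+ n - + 1) + 1ℤ)
      equation = trans (24m+1 (m H)) (trans (24=4*6 (+ m H))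
        (trans (cong (λ z → + 4 * z + 1ℤ) size) (lemma (+ n))))

-- The theorem assembled from the integer bounds

open import Data.Nat using (ℕ)
open import Data.Integer using (+_)
open import Data.Rational using (ℚ; _/_; _≤_; _+_; _*_; 1ℚ)
open import Data.Product using (_×_; Σ; _,_; map₂)

theorem1p1 : (∀ n (H : Graph3 n) → Σ (Cut2 n) λ f →
    √ (24 Data.Nat.* m H Data.Nat.+ 1) ≤ (ℕtoℚ 16 * excess H f + 1ℚ))
    × (∀ n (H : Graph3 n) → Connected H → Σ (Cut2 n) λ f →
    ((+ n Data.Integer.- + 1) / 8) ≤ excess H f)
    × (∀ n (H : Graph3 n) → 1 Data.Nat.≤ n → Steiner H →
    MaxExcessIs H ((+ n Data.Integer.- + 1) / 8)
    × IsSqrt (24 Data.Nat.* m H Data.Nat.+ 1) (ℕtoℚ 16 * ((+ n Data.Integer.- + 1) / 8) + 1ℚ))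
    × (∀ n (H : Graph3 n) → NoIsolated H → Σ (Cut2 n) λ f →
    (+ n / 12) ≤ excess H f)
    × (∀ n (H : Graph3 n) → PerfectMatching H →
    MaxExcessIs H (+ n / 12))
theorem1p1 =
    (λ n H → map₂ (λ { (0≤s , le) → sqrt-excess H 0≤s le }) (triple-bound H))
  , (λ n H → connected H)
  , (λ n H 1≤n steiner →
      -- Two vertices of a Steiner triple system share an edge, so the bound for connected
      -- hypergraphs applies and meets the upper bound.
      maximum H (connected H (steiner-connected H steiner)) (λ f → excess≤i/8 H (steiner-surplus≤ H steiner 1≤n f)) ,
      steiner-sqrt H 1≤n (steiner-size H steiner))
  , (λ n H → no-isolated H)
  , (λ n H perfect →
      maximum H (no-isolated H (matching-no-isolated H perfect)) (λ f → excess≤i/12 H (matching-surplus≤ H perfect f)))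
  where
  connected : ∀ {n} (H : Graph3 n) → Connected H → Σ (Cut2 n) λ f → ((+ n Data.Integer.- + 1) / 8) ≤ excess H f
  connected H conn = map₂ (excess≥i/8 H) (connected-surplus H conn)
  no-isolated : ∀ {n} (H : Graph3 n) → NoIsolated H → Σ (Cut2 n) λ f → (+ n / 12) ≤ excess H f
  no-isolated H iso = map₂ (excess≥i/12 H) (no-isolated-surplus H iso)
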